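{- Let $\mathbb{S}$ and $\mathbb{T}$ be two theories with prelude encoding such that $\mathbb{S}$ has an interpretation in $\mathbb{T}$. Then: 1. If $\vdash \Gamma$ in $\mathbb{S}$, then $\vdash \Gamma^{*,+}$ in $\mathbb{T}$. 2. If $\Gamma \vdash t : A$ in $\mathbb{S}$, then $\Gamma^{*,+} \vdash t^* : A^*$ in $\mathbb{T}$. 3. (a) If $\Gamma \vdash t : A$ and $\Gamma \vdash A : \mathtt{TYPE}$ in $\mathbb{S}$, then $\Gamma^{*,+} \vdash t^+ : A^+\ t^*$ in $\mathbb{T}$. (b) If $\Gamma \vdash t : A$ and $\Gamma \vdash A : \mathtt{KIND}$ in $\mathbb{S}$, then $\Gamma^{*,+} \vdash t^+ : A^+\{t^*\}$ in $\mathbb{T}$. (c) If $\Gamma \vdash A : \mathtt{KIND}$ in $\mathbb{S}$, then for every $t$ such that $\Gamma^{*,+} \vdash t : A^*$ in $\mathbb{T}$, we have $\Gamma^{*,+} \vdash A^+\{t\} : \mathtt{KIND}$ in $\mathbb{T}$.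
   Context: **The $\lambda\Pi$-calculus modulo theory.** Sorts: $s ::= \mathtt{TYPE} \mid \mathtt{KIND}$. Terms: $t,u,A,B ::= c \mid x \mid s \mid \Pi(x:A).\,B \mid \lambda(x:A).\,t \mid t\ u$, with $c$ a constant and $x$ a variable (disjoint sets); terms are taken modulo $\alpha$-renaming; $A \to B$ abbreviates $\Pi(x:A).\,B$ when $x$ is not free in $B$. Contexts: $\Gamma ::= \langle\rangle \mid \Gamma, x:A$. Signatures: $\Sigma ::= \langle\rangle \mid \Sigma, c:A \mid \Sigma, \ell \hookrightarrow r$, where in $c:A$ the term $A$ is closed and in a rewrite rule $\ell\hookrightarrow r$ the head symbol of $\ell$ is a constant. $\hookrightarrow_{\beta\Sigma}$ is the smallest relation closed by context containing $\beta$-reduction and all substitution instances of the rules of $\Sigma$; $\equiv_{\beta\Sigma}$ is its reflexive, symmetric, transitive closure. Typing rules (for fixed $\Sigma$; $\vdash t:A$ means empty context): - [Empty] $\vdash \langle\rangle$. - [Decl] from $\vdash\Gamma$ and $\Gamma\vdash A:\mathtt{TYPE}$, with $x\notin\Gamma$, infer $\vdash\Gamma,x:A$. - [Sort] from $\vdash\Gamma$ infer $\Gamma\vdash\mathtt{TYPE}:\mathtt{KIND}$. - [Const] from $\vdash\Gamma$ and $\vdash A:s$, with $c:A\in\Sigma$, infer $\Gamma\vdash c:A$. - [Var] from $\vdash\Gamma$, with $x:A\in\Gamma$, infer $\Gamma\vdash x:A$. - [Prod] from $\Gamma\vdash A:\mathtt{TYPE}$ and $\Gamma,x:A\vdash B:s$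 infer $\Gamma\vdash\Pi(x:A).\,B:s$. - [Abs] from $\Gamma\vdash A:\mathtt{TYPE}$, $\Gamma,x:A\vdash B:s$ and $\Gamma,x:A\vdash t:B$ infer $\Gamma\vdash\lambda(x:A).\,t:\Pi(x:A).\,B$. - [App] from $\Gamma\vdash t:\Pi(x:A).\,B$ and $\Gamma\vdash u:A$ infer $\Gamma\vdash t\ u:B[x\leftarrow u]$. - [Conv] from $\Gamma\vdash t:A$ and $\Gamma\vdash B:s$, with $A\equiv_{\beta\Sigma}B$, infer $\Gamma\vdash t:B$. **Theories.** Let $\Lambda_\Sigma$ be the set of terms whose constants belong to $\Sigma$. A theory is a signature $\Sigma$ such that (1) for each rule $\ell\hookrightarrow r\in\Sigma$, $\ell,r\in\Lambda_\Sigma$; (2) $\hookrightarrow_{\beta\Sigma}$ is confluent on $\Lambda_\Sigma$; (3) for each rule $\ell\hookrightarrow r\in\Sigma$, every context $\Gamma$, term $A\in\Lambda_\Sigma$ and substitution $\theta$, if $\Gamma\vdash\ell\theta:A$ then $\Gamma\vdash r\theta:A$. A judgment holds "in $\mathbb{T}$" if it is derivable with the signature of $\mathbb{T}$. **Prelude encoding.** $\Sigma_{pre}$ consists of the constants $\mathit{Set}:\mathtt{TYPE}$; $o:\mathit{Set}$; $\mathit{El}:\mathit{Set}\to\mathtt{TYPE}$; $\mathit{Prf}:\mathit{El}\ o\to\mathtt{TYPE}$; $\rightsquigarrow_d\,:\Pi(x:\mathit{Set}).\,(\mathit{El}\ x\to\mathit{Set})\to\mathit{Set}$ (infix); $\Rightarrow_d\,:\Pi(x:\mathit{El}\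 o).\,(\mathit{Prf}\ x\to\mathit{El}\ o)\to\mathit{El}\ o$ (infix); $\pi:\Pi(x:\mathit{El}\ o).\,(\mathit{Prf}\ x\to\mathit{Set})\to\mathit{Set}$; $\forall:\Pi(x:\mathit{Set}).\,(\mathit{El}\ x\to\mathit{El}\ o)\to\mathit{El}\ o$; and the rewrite rules $\mathit{El}\ (x\rightsquigarrow_d y)\hookrightarrow\Pi(z:\mathit{El}\ x).\,\mathit{El}\ (y\ z)$; $\mathit{Prf}\ (x\Rightarrow_d y)\hookrightarrow\Pi(z:\mathit{Prf}\ x).\,\mathit{Prf}\ (y\ z)$; $\mathit{El}\ (\pi\ x\ y)\hookrightarrow\Pi(z:\mathit{Prf}\ x).\,\mathit{El}\ (y\ z)$; $\mathit{Prf}\ (\forall\ x\ y)\hookrightarrow\Pi(z:\mathit{El}\ x).\,\mathit{Prf}\ (y\ z)$. A theory with prelude encoding is a theory $\mathbb{T}=\Sigma_{pre}\cup\Sigma_{\mathbb{T}}$ such that $\vdash A:\mathtt{TYPE}$ for every $c:A\in\Sigma_{\mathbb{T}}$. **Translations.** Each variable $x$ is associated with two fresh variables $x^*,x^+$; each constant $c$ of the source theory with two parameters (terms of the target theory) $c^*,c^+$. The function $t\mapsto t^*$ is defined by: variable $x\mapsto x^*$; constant $c\mapsto c^*$; $\mathtt{TYPE}^*:=\mathtt{TYPE}$; $\mathtt{KIND}^*:=\mathtt{KIND}$; $(t\ u)^*:=t^*\ u^*\ u^+$; $(\lambda(x:A).\,t)^*:=\lambda(x^*:A^*)(x^+:A^+\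 x^*).\,t^*$; $(\Pi(x:A).\,B)^*:=\Pi(x^*:A^*)(x^+:A^+\ x^*).\,B^*$. The function $t\mapsto t^+$ is defined by: variable $x\mapsto x^+$; constant $c\mapsto c^+$; $\mathtt{TYPE}^+\{X\}:=X\to\mathtt{TYPE}$; $\mathtt{KIND}^+:=\mathtt{KIND}$; $(t\ u)^+:=t^+\ u^*\ u^+$; $(\lambda(x:A).\,t)^+:=\lambda(x^*:A^*)(x^+:A^+\ x^*).\,t^+$; if $B:\mathtt{TYPE}$, $(\Pi(x:A).\,B)^+:=\lambda(f:(\Pi(x:A).\,B)^*).\,\Pi(x^*:A^*)(x^+:A^+\ x^*).\,B^+\ (f\ x^*\ x^+)$; if $B:\mathtt{KIND}$, $(\Pi(x:A).\,B)^+\{X\}:=\Pi(x^*:A^*)(x^+:A^+\ x^*).\,B^+\{X\ x^*\ x^+\}$. Here $X$ is a metavariable (placeholder): when $A:\mathtt{KIND}$, $A^+\{X\}$ is an expression containing $X$, and $A^+\{t\}$ denotes the result of replacing $X$ by $t$ in it. On contexts: $\langle\rangle^{*,+}:=\langle\rangle$ and $(\Gamma,x:A)^{*,+}:=\Gamma^{*,+},x^*:A^*,x^+:A^+\ x^*$. **Fixed parameters for $\Sigma_{pre}$.** Throughout, the parameters of the prelude constants are: - $\mathit{Set}^*:=\mathit{Set}$; $\mathit{Set}^+:=\lambda(x:\mathit{Set}).\,\mathit{El}\ x\to\mathit{El}\ o$. - $o^*:=o$; $o^+:=\lambda(z:\mathit{El}\ o).\,z\Rightarrow_d(\lambda(x:\mathit{Prf}\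 z).\,z)$. - $\mathit{El}^*:=\lambda(x^*:\mathit{Set})(x^+:\mathit{El}\ x^*\to\mathit{El}\ o).\,\mathit{El}\ x^*$; $\mathit{El}^+:=\lambda(u^*:\mathit{Set})(u^+:\mathit{El}\ u^*\to\mathit{El}\ o)(x:\mathit{El}\ u^*).\,\mathit{Prf}\ (u^+\ x)$. - $\mathit{Prf}^*:=\lambda(x^*:\mathit{El}\ o)(x^+:\mathit{Prf}\ (o^+\ x^*)).\,\mathit{Prf}\ x^*$; $\mathit{Prf}^+:=\lambda(u^*:\mathit{El}\ o)(u^+:\mathit{Prf}\ (o^+\ u^*))(x:\mathit{Prf}\ u^*).\,\mathit{Prf}\ u^*$. - For $\rightsquigarrow_d$, both parameters start with the abstractions $\lambda(a^*:\mathit{Set})(a^+:\mathit{El}\ a^*\to\mathit{El}\ o)(b^*:\Pi(x^*:\mathit{El}\ a^*).\,\mathit{Prf}\ (a^+\ x^*)\to\mathit{Set})(b^+:\Pi(x^*:\mathit{El}\ a^*)(x^+:\mathit{Prf}\ (a^+\ x^*)).\,\mathit{El}\ (b^*\ x^*\ x^+)\to\mathit{El}\ o)$. Body of $\rightsquigarrow_d^*$: $a^*\rightsquigarrow_d(\lambda(x^*:\mathit{El}\ a^*).\,\pi\ (a^+\ x^*)\ (b^*\ x^*))$. Body of $\rightsquigarrow_d^+$: $\lambda(f:\mathit{El}\ (\rightsquigarrow_d^*\ a^*\ a^+\ b^*\ b^+)).\,\forall\ a^*\ (\lambda(x^*:\mathit{El}\ a^*).\,(a^+\ x^*)\Rightarrow_d(\lambda(x^+:\mathit{Prf}\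 (a^+\ x^*)).\,b^+\ x^*\ x^+\ (f\ x^*\ x^+)))$. - For $\Rightarrow_d$, both start with $\lambda(a^*:\mathit{El}\ o)(a^+:\mathit{Prf}\ (o^+\ a^*))(b^*:\Pi(x^*:\mathit{Prf}\ a^*).\,\mathit{Prf}\ a^*\to\mathit{El}\ o)(b^+:\Pi(x^*:\mathit{Prf}\ a^*)(x^+:\mathit{Prf}\ a^*).\,\mathit{Prf}\ (o^+\ (b^*\ x^*\ x^+)))$. Body of $\Rightarrow_d^*$: $a^*\Rightarrow_d(\lambda(x^*:\mathit{Prf}\ a^*).\,a^*\Rightarrow_d(b^*\ x^*))$. Body of $\Rightarrow_d^+$: $\lambda(p:\mathit{Prf}\ (\Rightarrow_d^*\ a^*\ a^+\ b^*\ b^+)).\,p$. - For $\pi$, both start with $\lambda(a^*:\mathit{El}\ o)(a^+:\mathit{Prf}\ (o^+\ a^*))(b^*:\Pi(x^*:\mathit{Prf}\ a^*).\,\mathit{Prf}\ a^*\to\mathit{Set})(b^+:\Pi(x^*:\mathit{Prf}\ a^*)(x^+:\mathit{Prf}\ a^*).\,\mathit{El}\ (b^*\ x^*\ x^+)\to\mathit{El}\ o)$. Body of $\pi^*$: $\pi\ a^*\ (\lambda(x^*:\mathit{Prf}\ a^*).\,\pi\ a^*\ (b^*\ x^*))$. Body of $\pi^+$: $\lambda(f:\mathit{El}\ (\pi^*\ a^*\ a^+\ b^*\ b^+)).\,a^*\Rightarrow_d(\lambda(x^*:\mathit{Prf}\ a^*).\,a^*\Rightarrow_d(\lambda(x^+:\mathit{Prf}\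 a^*).\,b^+\ x^*\ x^+\ (f\ x^*\ x^+)))$. - For $\forall$, both start with $\lambda(a^*:\mathit{Set})(a^+:\mathit{El}\ a^*\to\mathit{El}\ o)(b^*:\Pi(x^*:\mathit{El}\ a^*).\,\mathit{Prf}\ (a^+\ x^*)\to\mathit{El}\ o)(b^+:\Pi(x^*:\mathit{El}\ a^*)(x^+:\mathit{Prf}\ (a^+\ x^*)).\,\mathit{Prf}\ (o^+\ (b^*\ x^*\ x^+)))$. Body of $\forall^*$: $\forall\ a^*\ (\lambda(x^*:\mathit{El}\ a^*).\,(a^+\ x^*)\Rightarrow_d(b^*\ x^*))$. Body of $\forall^+$: $\lambda(p:\mathit{Prf}\ (\forall^*\ a^*\ a^+\ b^*\ b^+)).\,p$. **Interpretation of theories.** For theories with prelude encoding $\mathbb{S}=\Sigma_{pre}\cup\Sigma_{\mathbb{S}}$ and $\mathbb{T}$, $\mathbb{S}$ has an interpretation in $\mathbb{T}$ when (1) for each $c:A\in\Sigma_{\mathbb{S}}$ we have a term $c^*$ with $\vdash c^*:A^*$ in $\mathbb{T}$; (2) for each $c:A\in\Sigma_{\mathbb{S}}$ we have a term $c^+$ with $\vdash c^+:A^+\ c^*$ in $\mathbb{T}$; (3) for each rewrite rule $\ell\hookrightarrow r\in\Sigma_{\mathbb{S}}$, $\ell^*\equiv_{\beta\Sigma}r^*$ and $\ell^+\equiv_{\beta\Sigma}r^+$ in $\mathbb{T}$. The translations in the claim are taken with respect to these parameters (and the fixed ones for $\Sigma_{pre}$). -}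

module Defs where

open import Data.Bool using (Bool; true; false; if_then_else_)
open import Data.Empty using (⊥-elim)
open import Data.Fin using (Fin; zero; suc)
open import Data.Fin.Patterns using (0F; 1F; 2F; 3F; 4F; 5F)
open import Data.List using (List; []; _∷_; _++_)
open import Data.List.Membership.Propositional using (_∈_)
open import Data.List.Relation.Unary.Any using (here; there)
open import Data.Nat using (ℕ; zero; suc; _*_)
import Data.Nat.Properties as ℕ
open import Data.Product using (∃; _×_; _,_; proj₁; proj₂)
open import Data.Sum using (_⊎_; inj₁; inj₂)
open import Function using (_∘_; _on_)
open import Relation.Binary.Construct.Closure.Equivalence using (EqClosure; gmap)
open import Relation.Binary.PropositionalEquality
  using (_≡_; _≢_; refl; sym; trans; cong; cong₂; subst; subst₂)
open import Relation.Binary.Rewriting using (Confluent; IsNormalForm; conf⇒unf)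
open import Relation.Nullary using (¬_; Dec; yes; no)
open import Relation.Nullary.Decidable using (map′)

data Sort : Set where
  TYPE KIND : Sort

data Prelude : Set where
  set o el prf arr imp pi all : Prelude

-- A countable supply of constants, some reserved for the prelude.
data Const : Set where
  pre   : Prelude → Const
  other : ℕ → Const

infixl 8 _·_

data Term (n : ℕ) : Set where
  con  : Const → Term n
  var  : Fin n → Term n
  sort : Sort → Term n
  Π    : Term n → Term (suc n) → Term n
  ƛ    : Term n → Term (suc n) → Term n
  _·_  : Term n → Term n → Term n

variable
  k m n : ℕ

ext : (Fin m → Fin n) → Fin (suc m) → Fin (suc n)
ext f zero    = zero
ext f (suc i) = suc (f i)

ren : (Fin m → Fin n) → Term m → Term n
ren f (con c)  = con c
ren f (var i)  = var (f i)
ren f (sort s) = sort s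
ren f (Π A B)  = Π (ren f A) (ren (ext f) B)
ren f (ƛ A t)  = ƛ (ren f A) (ren (ext f) t)
ren f (t · u)  = ren f t · ren f u

wk : Term n → Term (suc n)
wk = ren suc

-- Closed terms in an arbitrary scope.
wk₀ : Term 0 → Term n
wk₀ = ren (λ ())

Subst : ℕ → ℕ → Set
Subst m n = Fin m → Term n

exts : Subst m n → Subst (suc m) (suc n)
exts θ zero    = var zero
exts θ (suc i) = wk (θ i)

infixl 9 _⟪_⟫ _[_]

_⟪_⟫ : Term m → Subst m n → Term n
con c  ⟪ θ ⟫ = con c
var i  ⟪ θ ⟫ = θ i
sort s ⟪ θ ⟫ = sort s
Π A B  ⟪ θ ⟫ = Π (A ⟪ θ ⟫) (B ⟪ exts θ ⟫)
ƛ A t  ⟪ θ ⟫ = ƛ (A ⟪ θ ⟫) (t ⟪ exts θ ⟫)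
(t · u) ⟪ θ ⟫ = t ⟪ θ ⟫ · u ⟪ θ ⟫

single : Term n → Subst (suc n) n
single u zero    = u
single u (suc i) = var i

_[_] : Term (suc n) → Term n → Term n
t [ u ] = t ⟪ single u ⟫

infixr 7 _⟶_

_⟶_ : Term n → Term n → Term n
A ⟶ B = Π A (wk B)

data Ctx : ℕ → Set where
  ∅   : Ctx 0
  _▹_ : Ctx n → Term n → Ctx (suc n)

infixl 5 _▹_

lookup : Ctx n → Fin n → Term n
lookup (Γ ▹ A) zero    = wk A
lookup (Γ ▹ A) (suc i) = wk (lookup Γ i)

data ConstHeaded {n} : Term n → Set where
  con : ∀ c → ConstHeaded (con c)
  app : ∀ {t} → ConstHeaded t → ∀ u → ConstHeaded (t · u)

data Entry : Set where
  decl : Const → Term 0 → Entry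
  rule : (ℓ r : Term k) → ConstHeaded ℓ → Entry

Signature : Set
Signature = List Entry

Declared : Signature → Const → Set
Declared 𝒮 c = ∃ λ A → decl c A ∈ 𝒮

data Λ (𝒮 : Signature) {n} : Term n → Set where
  con  : ∀ {c} → Declared 𝒮 c → Λ 𝒮 (con c)
  var  : ∀ i → Λ 𝒮 (var i)
  sort : ∀ s → Λ 𝒮 (sort s)
  Π    : ∀ {A B} → Λ 𝒮 A → Λ 𝒮 B → Λ 𝒮 (Π A B)
  ƛ    : ∀ {A t} → Λ 𝒮 A → Λ 𝒮 t → Λ 𝒮 (ƛ A t)
  _·_  : ∀ {t u} → Λ 𝒮 t → Λ 𝒮 u → Λ 𝒮 (t · u)

infix 4 _∣_↪_ _∣_≡βΣ_

data _∣_↪_ (𝒮 : Signature) {n} : Term n → Term n → Set where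
  β    : ∀ {A t u} → 𝒮 ∣ ƛ A t · u ↪ t [ u ]
  rule : ∀ {k} {ℓ r : Term k} {h} → rule ℓ r h ∈ 𝒮 →
         (θ : Subst k n) → 𝒮 ∣ ℓ ⟪ θ ⟫ ↪ r ⟪ θ ⟫
  Πˡ   : ∀ {A A′ B} → 𝒮 ∣ A ↪ A′ → 𝒮 ∣ Π A B ↪ Π A′ B
  Πʳ   : ∀ {A B B′} → 𝒮 ∣ B ↪ B′ → 𝒮 ∣ Π A B ↪ Π A B′
  ƛˡ   : ∀ {A A′ t} → 𝒮 ∣ A ↪ A′ → 𝒮 ∣ ƛ A t ↪ ƛ A′ t
  ƛʳ   : ∀ {A t t′} → 𝒮 ∣ t ↪ t′ → 𝒮 ∣ ƛ A t ↪ ƛ A t′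
  ·ˡ   : ∀ {t t′ u} → 𝒮 ∣ t ↪ t′ → 𝒮 ∣ t · u ↪ t′ · u
  ·ʳ   : ∀ {t u u′} → 𝒮 ∣ u ↪ u′ → 𝒮 ∣ t · u ↪ t · u′

_∣_≡βΣ_ : Signature → Term n → Term n → Set
𝒮 ∣ t ≡βΣ u = EqClosure (𝒮 ∣_↪_) t u

infix 3 _⊢_ _∣_⊢_∶_

data _⊢_ (𝒮 : Signature) : Ctx n → Set
data _∣_⊢_∶_ (𝒮 : Signature) : Ctx n → Term n → Term n → Set

data _⊢_ 𝒮 where
  empty : 𝒮 ⊢ ∅
  decl  : ∀ {Γ : Ctx n} {A} →
          𝒮 ⊢ Γ → 𝒮 ∣ Γ ⊢ A ∶ sort TYPE → 𝒮 ⊢ Γ ▹ A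

data _∣_⊢_∶_ 𝒮 where
  sort  : ∀ {Γ : Ctx n} →
          𝒮 ⊢ Γ → 𝒮 ∣ Γ ⊢ sort TYPE ∶ sort KIND
  const : ∀ {Γ : Ctx n} {c A s} →
          𝒮 ⊢ Γ → 𝒮 ∣ ∅ ⊢ A ∶ sort s → decl c A ∈ 𝒮 →
          𝒮 ∣ Γ ⊢ con c ∶ wk₀ A
  var   : ∀ {Γ : Ctx n} →
          𝒮 ⊢ Γ → ∀ i → 𝒮 ∣ Γ ⊢ var i ∶ lookup Γ i
  prod  : ∀ {Γ : Ctx n} {A B s} →
          𝒮 ∣ Γ ⊢ A ∶ sort TYPE → 𝒮 ∣ Γ ▹ A ⊢ B ∶ sort s →
          𝒮 ∣ Γ ⊢ Π A B ∶ sort s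
  abs   : ∀ {Γ : Ctx n} {A B t s} →
          𝒮 ∣ Γ ⊢ A ∶ sort TYPE → 𝒮 ∣ Γ ▹ A ⊢ B ∶ sort s →
          𝒮 ∣ Γ ▹ A ⊢ t ∶ B →
          𝒮 ∣ Γ ⊢ ƛ A t ∶ Π A B
  app   : ∀ {Γ : Ctx n} {A B t u} →
          𝒮 ∣ Γ ⊢ t ∶ Π A B → 𝒮 ∣ Γ ⊢ u ∶ A →
          𝒮 ∣ Γ ⊢ t · u ∶ B [ u ]
  conv  : ∀ {Γ : Ctx n} {A B t s} →
          𝒮 ∣ Γ ⊢ t ∶ A → 𝒮 ∣ Γ ⊢ B ∶ sort s → 𝒮 ∣ A ≡βΣ B →
          𝒮 ∣ Γ ⊢ t ∶ B

record IsTheory (𝒮 : Signature) : Set where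
  field
    rules-in-Λ : ∀ {k} {ℓ r : Term k} {h} → rule ℓ r h ∈ 𝒮 → Λ 𝒮 ℓ × Λ 𝒮 r
    confluent  : ∀ n → Confluent {A = ∃ (Λ 𝒮 {n})} ((𝒮 ∣_↪_) on proj₁)
    preserving : ∀ {k} {ℓ r : Term k} {h} → rule ℓ r h ∈ 𝒮 →
                 ∀ {n} (Γ : Ctx n) {A : Term n} → Λ 𝒮 A → (θ : Subst k n) →
                 𝒮 ∣ Γ ⊢ ℓ ⟪ θ ⟫ ∶ A → 𝒮 ∣ Γ ⊢ r ⟪ θ ⟫ ∶ A

Setₜ oₜ : Term n
Setₜ = con (pre set)
oₜ   = con (pre o)

El Prf : Term n → Term n
El t  = con (pre el) · t
Prf t = con (pre prf) · t

infixr 7 _⇝_ _⇒_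

_⇝_ _⇒_ piₜ allₜ : Term n → Term n → Term n
a ⇝ b    = con (pre arr) · a · b
a ⇒ b    = con (pre imp) · a · b
piₜ a b  = con (pre pi) · a · b
allₜ a b = con (pre all) · a · b

Σpre : Signature
Σpre =
    decl (pre set) (sort TYPE)
  ∷ decl (pre o)   Setₜ
  ∷ decl (pre el)  (Setₜ ⟶ sort TYPE)
  ∷ decl (pre prf) (El oₜ ⟶ sort TYPE)
  ∷ decl (pre arr) (Π Setₜ ((El (var 0F) ⟶ Setₜ) ⟶ Setₜ))
  ∷ decl (pre imp) (Π (El oₜ) ((Prf (var 0F) ⟶ El oₜ) ⟶ El oₜ))
  ∷ decl (pre pi)  (Π (El oₜ) ((Prf (var 0F) ⟶ Setₜ) ⟶ Setₜ))
  ∷ decl (pre all) (Π Setₜ ((El (var 0F) ⟶ El oₜ) ⟶ El oₜ))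
  ∷ rule {2} (El (x ⇝ y))     (Π (El x)  (El  (wk y · var 0F))) (app (con _) _)
  ∷ rule {2} (Prf (x ⇒ y))    (Π (Prf x) (Prf (wk y · var 0F))) (app (con _) _)
  ∷ rule {2} (El (piₜ x y))   (Π (Prf x) (El  (wk y · var 0F))) (app (con _) _)
  ∷ rule {2} (Prf (allₜ x y)) (Π (El x)  (Prf (wk y · var 0F))) (app (con _) _)
  ∷ []
  where
  x y : Term 2
  x = var 1F
  y = var 0F

record PreludeTheory : Set where
  field
    extra    : Signature
    isTheory : IsTheory (Σpre ++ extra)
    small    : ∀ {c A} → decl c A ∈ extra →
               (Σpre ++ extra) ∣ ∅ ⊢ A ∶ sort TYPE

  signature : Signature
  signature = Σpre ++ extra

-- In each telescope below, the comments list the bound variables in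
-- scope, outermost first; the last one has index 0.

o⁺ : Term 0
o⁺ = ƛ (El oₜ) (var 0F ⇒ ƛ (Prf (var 0F)) (var 1F))

-- λ (a* : Set) (a⁺ : El a* → El o)
--   (b* : Π (x* : El a*). Prf (a⁺ x*) → Set)
--   (b⁺ : Π (x* : El a*) (x⁺ : Prf (a⁺ x*)). El (b* x* x⁺) → El o)
tel-arr : Term 4 → Term 0
tel-arr body =
  ƛ Setₜ
  (ƛ (El (var 0F) ⟶ El oₜ)
  (ƛ (Π (El (var 1F)) (Prf (var 1F · var 0F) ⟶ Setₜ))
  (ƛ (Π (El (var 2F)) (Π (Prf (var 2F · var 0F))
        (El (var 2F · var 1F · var 0F) ⟶ El oₜ)))
   body)))

-- λ (a* : El o) (a⁺ : Prf (o⁺ a*))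
--   (b* : Π (x* : Prf a*). Prf a* → El o)
--   (b⁺ : Π (x* : Prf a*) (x⁺ : Prf a*). Prf (o⁺ (b* x* x⁺)))
tel-imp : Term 4 → Term 0
tel-imp body =
  ƛ (El oₜ)
  (ƛ (Prf (wk₀ o⁺ · var 0F))
  (ƛ (Π (Prf (var 1F)) (Prf (var 2F) ⟶ El oₜ))
  (ƛ (Π (Prf (var 2F)) (Π (Prf (var 3F))
        (Prf (wk₀ o⁺ · (var 2F · var 1F · var 0F)))))
   body)))

-- λ (a* : El o) (a⁺ : Prf (o⁺ a*))
--   (b* : Π (x* : Prf a*). Prf a* → Set)
--   (b⁺ : Π (x* : Prf a*) (x⁺ : Prf a*). El (b* x* x⁺) → El o)
tel-pi : Term 4 → Term 0
tel-pi body =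
  ƛ (El oₜ)
  (ƛ (Prf (wk₀ o⁺ · var 0F))
  (ƛ (Π (Prf (var 1F)) (Prf (var 2F) ⟶ Setₜ))
  (ƛ (Π (Prf (var 2F)) (Π (Prf (var 3F))
        (El (var 2F · var 1F · var 0F) ⟶ El oₜ)))
   body)))

-- λ (a* : Set) (a⁺ : El a* → El o)
--   (b* : Π (x* : El a*). Prf (a⁺ x*) → El o)
--   (b⁺ : Π (x* : El a*) (x⁺ : Prf (a⁺ x*)). Prf (o⁺ (b* x* x⁺)))
tel-all : Term 4 → Term 0
tel-all body =
  ƛ Setₜ
  (ƛ (El (var 0F) ⟶ El oₜ)
  (ƛ (Π (El (var 1F)) (Prf (var 1F · var 0F) ⟶ El oₜ))
  (ƛ (Π (El (var 2F)) (Π (Prf (var 2F · var 0F))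
        (Prf (wk₀ o⁺ · (var 2F · var 1F · var 0F)))))
   body)))

pre* : Prelude → Term 0
pre* set = Setₜ
pre* o   = oₜ
pre* el  = ƛ Setₜ (ƛ (El (var 0F) ⟶ El oₜ) (El (var 1F)))
pre* prf = ƛ (El oₜ) (ƛ (Prf (wk₀ o⁺ · var 0F)) (Prf (var 1F)))
-- a* a⁺ b* b⁺ x*
pre* arr = tel-arr
  (var 3F ⇝ ƛ (El (var 3F)) (piₜ (var 3F · var 0F) (var 2F · var 0F)))
pre* imp = tel-imp
  (var 3F ⇒ ƛ (Prf (var 3F)) (var 4F ⇒ (var 2F · var 0F)))
pre* pi  = tel-pi
  (piₜ (var 3F) (ƛ (Prf (var 3F)) (piₜ (var 4F) (var 2F · var 0F))))
pre* all = tel-all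
  (allₜ (var 3F) (ƛ (El (var 3F)) ((var 3F · var 0F) ⇒ (var 2F · var 0F))))

-- c* a* a⁺ b* b⁺
applied* : Prelude → Term 4
applied* c = wk₀ (pre* c) · var 3F · var 2F · var 1F · var 0F

pre⁺ : Prelude → Term 0
pre⁺ set = ƛ Setₜ (El (var 0F) ⟶ El oₜ)
pre⁺ o   = o⁺
pre⁺ el  =
  ƛ Setₜ (ƛ (El (var 0F) ⟶ El oₜ) (ƛ (El (var 1F)) (Prf (var 1F · var 0F))))
pre⁺ prf =
  ƛ (El oₜ) (ƛ (Prf (wk₀ o⁺ · var 0F)) (ƛ (Prf (var 1F)) (Prf (var 2F))))
-- a* a⁺ b* b⁺ f x* x⁺
pre⁺ arr = tel-arr
  (ƛ (El (applied* arr))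
    (allₜ (var 4F) (ƛ (El (var 4F))
      ((var 4F · var 0F) ⇒ ƛ (Prf (var 4F · var 0F))
        (var 3F · var 1F · var 0F · (var 2F · var 1F · var 0F))))))
pre⁺ imp = tel-imp (ƛ (Prf (applied* imp)) (var 0F))
-- a* a⁺ b* b⁺ f x* x⁺
pre⁺ pi  = tel-pi
  (ƛ (El (applied* pi))
    (var 4F ⇒ ƛ (Prf (var 4F))
      (var 5F ⇒ ƛ (Prf (var 5F))
        (var 3F · var 1F · var 0F · (var 2F · var 1F · var 0F)))))
pre⁺ all = tel-all (ƛ (Prf (applied* all)) (var 0F))

-- Decides "B : KIND" against "B : TYPE" in the definition of (Π(x:A).B)⁺.
-- The translation is applied to raw terms (in particular to both sides of
-- rewrite rules, which have no typing context), so the case split is on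
-- shape; `isKind-KIND` and `isKind-TYPE` at the end of this file show that
-- in every theory it is the typing condition.
isKind : Term n → Bool
isKind (sort TYPE) = true
isKind (Π A B)     = isKind B
isKind _           = false

-- x* and x⁺, where a scope of n variables x becomes x₁*, x₁⁺, …, xₙ*, xₙ⁺
_*ᵛ _⁺ᵛ : Fin n → Fin (n * 2)
zero  *ᵛ = suc zero
suc i *ᵛ = suc (suc (i *ᵛ))
zero  ⁺ᵛ = zero
suc i ⁺ᵛ = suc (suc (i ⁺ᵛ))

infix 10 _*ᵛ _⁺ᵛ

module Translation (other* other⁺ : ℕ → Term 0) where

  con* con⁺ : Const → Term 0
  con* (pre c)   = pre* c
  con* (other c) = other* c
  con⁺ (pre c)   = pre⁺ c
  con⁺ (other c) = other⁺ c

  infix 10 _⋆ _⁺ _⁺⟨_⟩ _⋆⁺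

  -- t ⁺⟨ X ⟩ is t⁺ with its placeholder filled by X. Where the placeholder
  -- is not supposed to occur in t⁺ we write t ⁺, which fills it with the
  -- untypable term KIND.
  _⋆ _⁺ : Term n → Term (n * 2)
  _⁺⟨_⟩ : Term n → Term (n * 2) → Term (n * 2)

  var i   ⋆ = var (i *ᵛ)
  con c   ⋆ = wk₀ (con* c)
  sort s  ⋆ = sort s
  (t · u) ⋆ = t ⋆ · u ⋆ · u ⁺
  ƛ A t   ⋆ = ƛ (A ⋆) (ƛ (wk (A ⁺) · var 0F) (t ⋆))
  Π A B   ⋆ = Π (A ⋆) (Π (wk (A ⁺) · var 0F) (B ⋆))

  t ⁺ = t ⁺⟨ sort KIND ⟩

  var i     ⁺⟨ X ⟩ = var (i ⁺ᵛ)
  con c     ⁺⟨ X ⟩ = wk₀ (con⁺ c)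
  sort TYPE ⁺⟨ X ⟩ = X ⟶ sort TYPE
  sort KIND ⁺⟨ X ⟩ = sort KIND
  (t · u)   ⁺⟨ X ⟩ = t ⁺ · u ⋆ · u ⁺
  ƛ A t     ⁺⟨ X ⟩ = ƛ (A ⋆) (ƛ (wk (A ⁺) · var 0F) (t ⁺))
  Π A B     ⁺⟨ X ⟩ =
    if isKind B
    then Π (A ⋆) (Π (wk (A ⁺) · var 0F)
           (B ⁺⟨ wk (wk X) · var 1F · var 0F ⟩))
    else ƛ (Π A B ⋆)  -- f
           (Π (wk (A ⋆)) (Π (wk (wk (A ⁺)) · var 0F)
             (ren (ext (ext suc)) (B ⁺) · (var 2F · var 1F · var 0F))))

  _⋆⁺ : Ctx n → Ctx (n * 2)
  ∅       ⋆⁺ = ∅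
  (Γ ▹ A) ⋆⁺ = Γ ⋆⁺ ▹ A ⋆ ▹ (wk (A ⁺) · var 0F)

record Interpretation (𝕊 𝕋 : PreludeTheory) : Set where
  open PreludeTheory
  -- Only the values at constants declared in 𝕊 matter.
  field
    other* other⁺ : ℕ → Term 0

  open Translation other* other⁺ public

  field
    con*-typed : ∀ {c A} → decl c A ∈ extra 𝕊 →
                 signature 𝕋 ∣ ∅ ⊢ con* c ∶ A ⋆
    con⁺-typed : ∀ {c A} → decl c A ∈ extra 𝕊 →
                 signature 𝕋 ∣ ∅ ⊢ con⁺ c ∶ A ⁺ · con* c
    rule*      : ∀ {k} {ℓ r : Term k} {h} → rule ℓ r h ∈ extra 𝕊 →
                 signature 𝕋 ∣ ℓ ⋆ ≡βΣ r ⋆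
    rule⁺      : ∀ {k} {ℓ r : Term k} {h} → rule ℓ r h ∈ extra 𝕊 →
                 signature 𝕋 ∣ ℓ ⁺ ≡βΣ r ⁺

-- KIND does not occur in well-typed terms.
data KindFree {n} : Term n → Set where
  con  : ∀ c → KindFree (con c)
  var  : ∀ i → KindFree (var i)
  TYPE : KindFree (sort TYPE)
  Π    : ∀ {A B} → KindFree A → KindFree B → KindFree (Π A B)
  ƛ    : ∀ {A t} → KindFree A → KindFree t → KindFree (ƛ A t)
  _·_  : ∀ {t u} → KindFree t → KindFree u → KindFree (t · u)

ren-kf : (f : Fin m → Fin n) {t : Term m} → KindFree t → KindFree (ren f t)
ren-kf f (con c) = con c
ren-kf f (var i) = var (f i)
ren-kf f TYPE    = TYPE
ren-kf f (Π A B) = Π (ren-kf f A) (ren-kf (ext f) B)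
ren-kf f (ƛ A t) = ƛ (ren-kf f A) (ren-kf (ext f) t)
ren-kf f (t · u) = ren-kf f t · ren-kf f u

exts-kf : {θ : Subst m n} → (∀ i → KindFree (θ i)) →
          ∀ i → KindFree (exts θ i)
exts-kf θk zero    = var zero
exts-kf θk (suc i) = ren-kf suc (θk i)

sub-kf : {θ : Subst m n} → (∀ i → KindFree (θ i)) →
         {t : Term m} → KindFree t → KindFree (t ⟪ θ ⟫)
sub-kf θk (con c) = con c
sub-kf θk (var i) = θk i
sub-kf θk TYPE    = TYPE
sub-kf θk (Π A B) = Π (sub-kf θk A) (sub-kf (exts-kf θk) B)
sub-kf θk (ƛ A t) = ƛ (sub-kf θk A) (sub-kf (exts-kf θk) t)
sub-kf θk (t · u) = sub-kf θk t · sub-kf θk u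

single-kf : {u : Term n} → KindFree u → ∀ i → KindFree (single u i)
single-kf uk zero    = uk
single-kf uk (suc i) = var i

sort-kf : ∀ s → _≡_ {A = Term n} (sort s) (sort KIND) ⊎ KindFree {n} (sort s)
sort-kf TYPE = inj₂ TYPE
sort-kf KIND = inj₁ refl

module _ {𝒮 : Signature} where

  ctx-kf : {Γ : Ctx n} → 𝒮 ⊢ Γ → ∀ i → KindFree (lookup Γ i)
  typed-kf : {Γ : Ctx n} {t A : Term n} → 𝒮 ∣ Γ ⊢ t ∶ A →
             KindFree t × (A ≡ sort KIND ⊎ KindFree A)

  ctx-kf (decl ⊢Γ ⊢A) zero    = ren-kf suc (proj₁ (typed-kf ⊢A))
  ctx-kf (decl ⊢Γ ⊢A) (suc i) = ren-kf suc (ctx-kf ⊢Γ i)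

  typed-kf (sort _)        = TYPE , inj₁ refl
  typed-kf (const _ ⊢A _)  = con _ , inj₂ (ren-kf _ (proj₁ (typed-kf ⊢A)))
  typed-kf (var ⊢Γ i)      = var i , inj₂ (ctx-kf ⊢Γ i)
  typed-kf (prod {s = s} ⊢A ⊢B) =
    Π (proj₁ (typed-kf ⊢A)) (proj₁ (typed-kf ⊢B)) , sort-kf s
  typed-kf (abs ⊢A ⊢B ⊢t)  =
    let Ak = proj₁ (typed-kf ⊢A) in
    ƛ Ak (proj₁ (typed-kf ⊢t)) , inj₂ (Π Ak (proj₁ (typed-kf ⊢B)))
  typed-kf (app ⊢t ⊢u) with typed-kf ⊢t | typed-kf ⊢u
  ... | tk , inj₂ (Π _ Bk) | uk , _ =
    (tk · uk) , inj₂ (sub-kf (single-kf uk) Bk)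
  typed-kf (conv ⊢t ⊢B _)  =
    proj₁ (typed-kf ⊢t) , inj₂ (proj₁ (typed-kf ⊢B))

KIND-not-kf : ¬ KindFree {n} (sort KIND)
KIND-not-kf ()

wk-KIND : {t : Term m} {f : Fin m → Fin n} →
          ren f t ≡ sort KIND → t ≡ sort KIND
wk-KIND {t = sort KIND} refl = refl

isKind-KIND : ∀ {𝒮} {Γ : Ctx n} {B : Term n} →
              𝒮 ∣ Γ ⊢ B ∶ sort KIND → isKind B ≡ true
isKind-KIND {n} {𝒮} ⊢B = go ⊢B refl
  where
  go : ∀ {n} {Γ : Ctx n} {B T} → 𝒮 ∣ Γ ⊢ B ∶ T → T ≡ sort KIND →
       isKind B ≡ true
  go (sort _) _ = refl
  go (const {A = A} _ ⊢A _) eq with wk-KIND {t = A} eq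
  ... | refl = ⊥-elim (KIND-not-kf (proj₁ (typed-kf ⊢A)))
  go (var ⊢Γ i) eq = ⊥-elim (KIND-not-kf (subst KindFree eq (ctx-kf ⊢Γ i)))
  go (prod _ ⊢B) refl = go ⊢B refl
  go (app ⊢t ⊢u) eq with typed-kf ⊢t | typed-kf ⊢u
  ... | _ , inj₂ (Π _ Bk) | uk , _ =
    ⊥-elim (KIND-not-kf (subst KindFree eq (sub-kf (single-kf uk) Bk)))
  go (conv _ ⊢B _) refl = ⊥-elim (KIND-not-kf (proj₁ (typed-kf ⊢B)))

-- Confluence is assumed on Λ 𝒮 only, while ≡βΣ is on all terms. Replacing
-- undeclared constants by TYPE maps conversions into Λ 𝒮.
module Erase (𝒮 : Signature) (th : IsTheory 𝒮) where
  open IsTheory th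

  _≟ᵖ_ : (c d : Prelude) → Dec (c ≡ d)
  c ≟ᵖ d = map′ code-inj (cong code) (code c ℕ.≟ code d)
    where
    code : Prelude → ℕ
    code set = 0
    code o   = 1
    code el  = 2
    code prf = 3
    code arr = 4
    code imp = 5
    code pi  = 6
    code all = 7
    decode : ℕ → Prelude
    decode 0 = set
    decode 1 = o
    decode 2 = el
    decode 3 = prf
    decode 4 = arr
    decode 5 = imp
    decode 6 = pi
    decode _ = all
    decode-code : ∀ c → decode (code c) ≡ c
    decode-code set = refl
    decode-code o   = refl
    decode-code el  = refl
    decode-code prf = refl
    decode-code arr = refl
    decode-code imp = refl
    decode-code pi  = refl
    decode-code all = refl
    code-inj : ∀ {c d} → code c ≡ code d → c ≡ d
    code-inj {c} {d} eq =
      trans (sym (decode-code c)) (trans (cong decode eq) (decode-code d))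

  _≟_ : (c d : Const) → Dec (c ≡ d)
  pre c   ≟ pre d   = map′ (cong pre) (λ { refl → refl }) (c ≟ᵖ d)
  pre c   ≟ other d = no λ ()
  other c ≟ pre d   = no λ ()
  other c ≟ other d = map′ (cong other) (λ { refl → refl }) (c ℕ.≟ d)

  declared? : ∀ 𝒮′ c → Dec (Declared 𝒮′ c)
  declared? [] c = no λ ()
  declared? (rule _ _ _ ∷ 𝒮′) c =
    map′ (λ (A , p) → A , there p) (λ { (A , there p) → A , p })
         (declared? 𝒮′ c)
  declared? (decl d A ∷ 𝒮′) c with c ≟ d
  ... | yes refl = yes (A , here refl)
  ... | no c≢d   =
    map′ (λ (A , p) → A , there p)
         (λ { (A , here refl) → ⊥-elim (c≢d refl)
            ; (A , there p)   → A , p })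
         (declared? 𝒮′ c)

  eraseᶜ : ∀ {c} → Dec (Declared 𝒮 c) → Term n
  eraseᶜ {c = c} (yes _) = con c
  eraseᶜ         (no _)  = sort TYPE

  erase : Term n → Term n
  erase (con c)  = eraseᶜ (declared? 𝒮 c)
  erase (var i)  = var i
  erase (sort s) = sort s
  erase (Π A B)  = Π (erase A) (erase B)
  erase (ƛ A t)  = ƛ (erase A) (erase t)
  erase (t · u)  = erase t · erase u

  erase-Λ : (t : Term n) → Λ 𝒮 (erase t)
  erase-Λ (con c) with declared? 𝒮 c
  ... | yes p = con p
  ... | no _  = sort TYPE
  erase-Λ (var i)  = var i
  erase-Λ (sort s) = sort s
  erase-Λ (Π A B)  = Π (erase-Λ A) (erase-Λ B)
  erase-Λ (ƛ A t)  = ƛ (erase-Λ A) (erase-Λ t)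
  erase-Λ (t · u)  = erase-Λ t · erase-Λ u

  erase-id : {t : Term n} → Λ 𝒮 t → erase t ≡ t
  erase-id (con {c} p) with declared? 𝒮 c
  ... | yes _ = refl
  ... | no ¬p = ⊥-elim (¬p p)
  erase-id (var i)  = refl
  erase-id (sort s) = refl
  erase-id (Π A B)  = cong₂ Π (erase-id A) (erase-id B)
  erase-id (ƛ A t)  = cong₂ ƛ (erase-id A) (erase-id t)
  erase-id (t · u)  = cong₂ _·_ (erase-id t) (erase-id u)

  erase-ren : (f : Fin m → Fin n) (t : Term m) →
              erase (ren f t) ≡ ren f (erase t)
  erase-ren f (con c) with declared? 𝒮 c
  ... | yes _ = refl
  ... | no _  = refl
  erase-ren f (var i)  = refl
  erase-ren f (sort s) = refl
  erase-ren f (Π A B)  = cong₂ Π (erase-ren f A) (erase-ren (ext f) B)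
  erase-ren f (ƛ A t)  = cong₂ ƛ (erase-ren f A) (erase-ren (ext f) t)
  erase-ren f (t · u)  = cong₂ _·_ (erase-ren f t) (erase-ren f u)

  erase-exts : {θ θ′ : Subst m n} → (∀ i → erase (θ i) ≡ θ′ i) →
               ∀ i → erase (exts θ i) ≡ exts θ′ i
  erase-exts         eq zero    = refl
  erase-exts {θ = θ} eq (suc i) = trans (erase-ren suc (θ i)) (cong wk (eq i))

  erase-sub : {θ θ′ : Subst m n} → (∀ i → erase (θ i) ≡ θ′ i) →
              (t : Term m) → erase (t ⟪ θ ⟫) ≡ erase t ⟪ θ′ ⟫
  erase-sub eq (con c) with declared? 𝒮 c
  ... | yes _ = refl
  ... | no _  = refl
  erase-sub eq (var i)  = eq i
  erase-sub eq (sort s) = refl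
  erase-sub eq (Π A B)  = cong₂ Π (erase-sub eq A) (erase-sub (erase-exts eq) B)
  erase-sub eq (ƛ A t)  = cong₂ ƛ (erase-sub eq A) (erase-sub (erase-exts eq) t)
  erase-sub eq (t · u)  = cong₂ _·_ (erase-sub eq t) (erase-sub eq u)

  erase-single : (u : Term n) → ∀ i → erase (single u i) ≡ single (erase u) i
  erase-single u zero    = refl
  erase-single u (suc i) = refl

  erase-step : {t u : Term n} → 𝒮 ∣ t ↪ u → 𝒮 ∣ erase t ↪ erase u
  erase-step (β {A} {t} {u}) =
    subst (𝒮 ∣ ƛ (erase A) (erase t) · erase u ↪_)
          (sym (erase-sub (erase-single u) t)) β
  erase-step (rule {ℓ = ℓ} {r = r} p θ) =
    subst₂ (𝒮 ∣_↪_) (lem ℓ (proj₁ (rules-in-Λ p))) (lem r (proj₂ (rules-in-Λ p)))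
           (rule p (erase ∘ θ))
    where
    lem : ∀ t → Λ 𝒮 t → t ⟪ erase ∘ θ ⟫ ≡ erase (t ⟪ θ ⟫)
    lem t tΛ = sym (trans (erase-sub (λ _ → refl) t)
                          (cong _⟪ erase ∘ θ ⟫ (erase-id tΛ)))
  erase-step (Πˡ s) = Πˡ (erase-step s)
  erase-step (Πʳ s) = Πʳ (erase-step s)
  erase-step (ƛˡ s) = ƛˡ (erase-step s)
  erase-step (ƛʳ s) = ƛʳ (erase-step s)
  erase-step (·ˡ s) = ·ˡ (erase-step s)
  erase-step (·ʳ s) = ·ʳ (erase-step s)

  sort-normal : ∀ s → IsNormalForm {A = ∃ (Λ 𝒮 {n})} ((𝒮 ∣_↪_) on proj₁)
                  (sort s , sort s)
  sort-normal s ((u , _) , st) = go st refl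
    where
    head : ∀ {k} {ℓ : Term k} → ConstHeaded ℓ → (θ : Subst k _) →
           ℓ ⟪ θ ⟫ ≢ sort s
    head (con c)   θ ()
    head (app _ _) θ ()
    go : ∀ {t u} → 𝒮 ∣ t ↪ u → t ≢ sort s
    go (rule {h = h} _ θ) eq = head h θ eq

  TYPE≢KIND : ¬ (_∣_≡βΣ_ {n} 𝒮 (sort TYPE) (sort KIND))
  TYPE≢KIND {n} eq
    with conf⇒unf (confluent n) (sort-normal TYPE) (sort-normal KIND)
           (gmap (λ t → erase t , erase-Λ t) erase-step eq)
  ... | ()

isKind-TYPE : ∀ {𝒮} → IsTheory 𝒮 → {Γ : Ctx n} {B : Term n} →
              𝒮 ∣ Γ ⊢ B ∶ sort TYPE → isKind B ≡ false
isKind-TYPE {𝒮 = 𝒮} th {B = B} ⊢B with isKind B in eq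
... | false = refl
... | true  = ⊥-elim (TYPE≢KIND (sym≡ (go ⊢B eq)))
  where
  open Erase 𝒮 th
  open import Relation.Binary.Construct.Closure.Equivalence
    using () renaming (reflexive to refl≡; transitive to trans≡; symmetric to symm)
  sym≡ : ∀ {n} {t u : Term n} → 𝒮 ∣ t ≡βΣ u → 𝒮 ∣ u ≡βΣ t
  sym≡ = symm _
  sort-cong : ∀ {n s s′} → _∣_≡βΣ_ {n} 𝒮 (sort s) (sort s′) → s ≡ s′
  sort-cong {s = TYPE} {TYPE} _ = refl
  sort-cong {s = KIND} {KIND} _ = refl
  sort-cong {s = TYPE} {KIND} e = ⊥-elim (TYPE≢KIND e)
  sort-cong {s = KIND} {TYPE} e = ⊥-elim (TYPE≢KIND (sym≡ e))
  go : ∀ {n} {Γ : Ctx n} {B T} → 𝒮 ∣ Γ ⊢ B ∶ T → isKind B ≡ true →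
       𝒮 ∣ sort KIND ≡βΣ T
  go (sort _)      _ = refl≡ _
  go (prod _ ⊢B) p with sort-cong (go ⊢B p)
  ... | refl = refl≡ _
  go (conv ⊢t _ e) p = trans≡ _ (go ⊢t p) e

{-# OPTIONS --safe #-}

-- The prelude parameters are checked against their types by a type inferer
-- that only uses the prelude constants and rules.  Conversion is the one
-- delicate case of the induction on derivations: A ≡ B may pass through
-- ill-typed terms, on which the translation (whose shape depends on whether a
-- codomain is a kind) need not respect reduction.  By confluence and subject
-- reduction in 𝕊, A and B have a common reduct through well-typed terms only,
-- and there kinds are TYPE and products ending in it, all other terms being
-- sort-free, so that the translations commute with the substitutions involved.
-- In the application case the types of the translated terms are unfolded by
-- subject reduction in 𝕋.

module Submission where

open import Defs
open import Data.Bool using (true; false; if_then_else_)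
open import Data.Empty using (⊥-elim)
open import Data.Fin as Fin using (Fin; zero; suc)
open import Data.Fin.Patterns using (0F; 1F; 2F)
open import Data.List using ([]; _∷_)
open import Data.List.Membership.Propositional using (_∈_)
open import Data.List.Membership.Propositional.Properties using (∈-++⁻)
open import Data.List.Relation.Unary.All as All using (All; []; _∷_)
open import Data.List.Relation.Unary.Any using (here; there)
open import Data.Maybe using (Maybe; just; nothing; map; _>>=_; to-witness-T)
open import Data.Nat using (ℕ; zero; suc; _*_)
open import Data.Product using (∃; _×_; _,_; proj₁; proj₂)
open import Data.Sum using (_⊎_; inj₁; inj₂)
open import Data.Unit using (⊤)
open import Function using (_∘_)
open import Relation.Binary.Construct.Closure.Equivalence as Eq using (EqClosure)
open import Relation.Binary.Construct.Closure.ReflexiveTransitive as Star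
  using (Star; ε; _◅_; _◅◅_)
open import Relation.Binary.Construct.Closure.Symmetric using (fwd; bwd)
open import Relation.Binary.PropositionalEquality
  using (_≡_; _≢_; refl; sym; trans; cong; cong₂; subst; subst₂)
open import Relation.Binary.Rewriting using (Confluent)
open import Relation.Nullary using (¬_; dec⇒maybe)

-- Renamings and substitutions

-- A rule of 𝕊 provides equations between its two open sides only, whereas a reduction step uses an
-- instance of it. Passing from one to the other means commuting the translations with substitution,
-- and this fails when a kind is substituted: replacing `y` by `TYPE` in `Π (x : A). y` changes the
-- plus translation from its λ form to its Π form, and the variable `y⁺` cannot record the
-- placeholder that `TYPE⁺` displays. So it has to be known that kinds are never substituted. In a
-- typed β-redex the argument inhabits a type of sort `TYPE`. In a rule instance the left-hand side
-- is headed by a constant, so when typed it is sort-free, and subject reduction carries this over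
-- to the right-hand side. The clause on kinds must range over all fillings of the placeholder,
-- because going under a binder replaces `X` by `X x* x⁺`.

module _ where
  private variable
    f : Fin k → Fin m
    g : Fin m → Fin n
    h : Fin k → Fin n
    θ : Subst k m
    σ : Subst m n
    τ : Subst k n

  ext-∘ : (∀ i → g (f i) ≡ h i) → ∀ i → ext g (ext f i) ≡ ext h i
  ext-∘ eq zero    = refl
  ext-∘ eq (suc i) = cong suc (eq i)

  ren-ren : (∀ i → g (f i) ≡ h i) → ∀ t → ren g (ren f t) ≡ ren h t
  ren-ren eq (con c)  = refl
  ren-ren eq (var i)  = cong var (eq i)
  ren-ren eq (sort s) = refl
  ren-ren eq (Π A B)  = cong₂ Π (ren-ren eq A) (ren-ren (ext-∘ eq) B)
  ren-ren eq (ƛ A t)  = cong₂ ƛ (ren-ren eq A) (ren-ren (ext-∘ eq) t)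
  ren-ren eq (t · u)  = cong₂ _·_ (ren-ren eq t) (ren-ren eq u)

  ren-wk : (f : Fin m → Fin n) (t : Term m) → ren (ext f) (wk t) ≡ wk (ren f t)
  ren-wk f t = trans (ren-ren (λ _ → refl) t) (sym (ren-ren (λ _ → refl) t))

  exts-ren : (∀ i → σ (f i) ≡ τ i) → ∀ i → exts σ (ext f i) ≡ exts τ i
  exts-ren eq zero    = refl
  exts-ren eq (suc i) = cong wk (eq i)

  sub-ren : (∀ i → σ (f i) ≡ τ i) → ∀ t → ren f t ⟪ σ ⟫ ≡ t ⟪ τ ⟫
  sub-ren eq (con c)  = refl
  sub-ren eq (var i)  = eq i
  sub-ren eq (sort s) = refl
  sub-ren eq (Π A B)  = cong₂ Π (sub-ren eq A) (sub-ren (exts-ren eq) B)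
  sub-ren eq (ƛ A t)  = cong₂ ƛ (sub-ren eq A) (sub-ren (exts-ren eq) t)
  sub-ren eq (t · u)  = cong₂ _·_ (sub-ren eq t) (sub-ren eq u)

  ren-exts : (∀ i → ren g (θ i) ≡ τ i) → ∀ i → ren (ext g) (exts θ i) ≡ exts τ i
  ren-exts         eq zero    = refl
  ren-exts {θ = θ} eq (suc i) = trans (ren-wk _ (θ i)) (cong wk (eq i))

  ren-sub : (∀ i → ren g (θ i) ≡ τ i) → ∀ t → ren g (t ⟪ θ ⟫) ≡ t ⟪ τ ⟫
  ren-sub eq (con c)  = refl
  ren-sub eq (var i)  = eq i
  ren-sub eq (sort s) = refl
  ren-sub eq (Π A B)  = cong₂ Π (ren-sub eq A) (ren-sub (ren-exts eq) B)
  ren-sub eq (ƛ A t)  = cong₂ ƛ (ren-sub eq A) (ren-sub (ren-exts eq) t)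
  ren-sub eq (t · u)  = cong₂ _·_ (ren-sub eq t) (ren-sub eq u)

  sub-wk : (σ : Subst m n) (t : Term m) → wk t ⟪ exts σ ⟫ ≡ wk (t ⟪ σ ⟫)
  sub-wk σ t = trans (sub-ren (λ _ → refl) t) (sym (ren-sub (λ _ → refl) t))

  exts-sub : (∀ i → θ i ⟪ σ ⟫ ≡ τ i) → ∀ i → exts θ i ⟪ exts σ ⟫ ≡ exts τ i
  exts-sub         eq zero    = refl
  exts-sub {θ = θ} eq (suc i) = trans (sub-wk _ (θ i)) (cong wk (eq i))

  sub-sub : (∀ i → θ i ⟪ σ ⟫ ≡ τ i) → ∀ t → t ⟪ θ ⟫ ⟪ σ ⟫ ≡ t ⟪ τ ⟫
  sub-sub eq (con c)  = refl
  sub-sub eq (var i)  = eq i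
  sub-sub eq (sort s) = refl
  sub-sub eq (Π A B)  = cong₂ Π (sub-sub eq A) (sub-sub (exts-sub eq) B)
  sub-sub eq (ƛ A t)  = cong₂ ƛ (sub-sub eq A) (sub-sub (exts-sub eq) t)
  sub-sub eq (t · u)  = cong₂ _·_ (sub-sub eq t) (sub-sub eq u)

exts-var : {θ : Subst n n} → (∀ i → θ i ≡ var i) → ∀ i → exts θ i ≡ var i
exts-var eq zero    = refl
exts-var eq (suc i) = cong wk (eq i)

sub-var : {θ : Subst n n} → (∀ i → θ i ≡ var i) → ∀ t → t ⟪ θ ⟫ ≡ t
sub-var eq (con c)  = refl
sub-var eq (var i)  = eq i
sub-var eq (sort s) = refl
sub-var eq (Π A B)  = cong₂ Π (sub-var eq A) (sub-var (exts-var eq) B)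
sub-var eq (ƛ A t)  = cong₂ ƛ (sub-var eq A) (sub-var (exts-var eq) t)
sub-var eq (t · u)  = cong₂ _·_ (sub-var eq t) (sub-var eq u)

ren≡sub : (f : Fin m → Fin n) (t : Term m) → ren f t ≡ t ⟪ var ∘ f ⟫
ren≡sub f t = trans (sym (sub-var (λ _ → refl) (ren f t))) (sub-ren (λ _ → refl) t)

wk-[] : (t u : Term n) → wk t [ u ] ≡ t
wk-[] t u = trans (sub-ren (λ _ → refl) t) (sub-var (λ _ → refl) t)

sub-[] : (σ : Subst m n) (t : Term (suc m)) (u : Term m) →
         t [ u ] ⟪ σ ⟫ ≡ t ⟪ exts σ ⟫ [ u ⟪ σ ⟫ ]
sub-[] σ t u = trans (sub-sub {τ = both} (λ { zero → refl ; (suc i) → refl }) t)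
  (sym (sub-sub (λ { zero → refl ; (suc i) → wk-[] (σ i) _ }) t))
  where
  both : Subst (suc _) _
  both zero    = u ⟪ σ ⟫
  both (suc i) = σ i

ren-[] : (f : Fin m → Fin n) (t : Term (suc m)) (u : Term m) →
         ren f (t [ u ]) ≡ ren (ext f) t [ ren f u ]
ren-[] f t u = trans (ren-sub (λ _ → refl) t)
  (sym (sub-ren (λ { zero → refl ; (suc i) → refl }) t))

-- Conversion

infix 4 _∣_↪*_

_∣_↪*_ : Signature → Term n → Term n → Set
𝒮 ∣ t ↪* u = Star (𝒮 ∣_↪_) t u

module _ {𝒮 : Signature} where

  ↪*⇒≡ : {t u : Term n} → 𝒮 ∣ t ↪* u → 𝒮 ∣ t ≡βΣ u
  ↪*⇒≡ = Star.map fwd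

  ≡-sym : {t u : Term n} → 𝒮 ∣ t ≡βΣ u → 𝒮 ∣ u ≡βΣ t
  ≡-sym = Eq.symmetric _

  ≡-reflexive : {t u : Term n} → t ≡ u → 𝒮 ∣ t ≡βΣ u
  ≡-reflexive refl = ε

  ↪-sub : (σ : Subst m n) {t u : Term m} → 𝒮 ∣ t ↪ u → 𝒮 ∣ t ⟪ σ ⟫ ↪ u ⟪ σ ⟫
  ↪-sub σ (β {A} {t} {u}) = subst (𝒮 ∣ ƛ A t ⟪ σ ⟫ · u ⟪ σ ⟫ ↪_) (sym (sub-[] σ t u)) β
  ↪-sub σ (rule {ℓ = ℓ} {r} p θ) =
    subst₂ (𝒮 ∣_↪_) (sym (sub-sub (λ _ → refl) ℓ)) (sym (sub-sub (λ _ → refl) r))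
      (rule p (λ i → θ i ⟪ σ ⟫))
  ↪-sub σ (Πˡ s) = Πˡ (↪-sub σ s)
  ↪-sub σ (Πʳ s) = Πʳ (↪-sub (exts σ) s)
  ↪-sub σ (ƛˡ s) = ƛˡ (↪-sub σ s)
  ↪-sub σ (ƛʳ s) = ƛʳ (↪-sub (exts σ) s)
  ↪-sub σ (·ˡ s) = ·ˡ (↪-sub σ s)
  ↪-sub σ (·ʳ s) = ·ʳ (↪-sub σ s)

  ≡-sub : (σ : Subst m n) {t u : Term m} → 𝒮 ∣ t ≡βΣ u → 𝒮 ∣ t ⟪ σ ⟫ ≡βΣ u ⟪ σ ⟫
  ≡-sub σ = Eq.gmap _⟪ σ ⟫ (↪-sub σ)

  ≡-ren : (f : Fin m → Fin n) {t u : Term m} → 𝒮 ∣ t ≡βΣ u → 𝒮 ∣ ren f t ≡βΣ ren f u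
  ≡-ren f {t} {u} eq =
    subst₂ (𝒮 ∣_≡βΣ_) (sym (ren≡sub f t)) (sym (ren≡sub f u)) (≡-sub (var ∘ f) eq)

  Π-cong : {A A′ : Term n} {B B′ : Term (suc n)} →
           𝒮 ∣ A ≡βΣ A′ → 𝒮 ∣ B ≡βΣ B′ → 𝒮 ∣ Π A B ≡βΣ Π A′ B′
  Π-cong p q = Eq.gmap (λ A → Π A _) Πˡ p ◅◅ Eq.gmap (Π _) Πʳ q

  ƛ-cong : {A A′ : Term n} {t t′ : Term (suc n)} →
           𝒮 ∣ A ≡βΣ A′ → 𝒮 ∣ t ≡βΣ t′ → 𝒮 ∣ ƛ A t ≡βΣ ƛ A′ t′
  ƛ-cong p q = Eq.gmap (λ A → ƛ A _) ƛˡ p ◅◅ Eq.gmap (ƛ _) ƛʳ q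

  ·-cong : {t t′ u u′ : Term n} →
           𝒮 ∣ t ≡βΣ t′ → 𝒮 ∣ u ≡βΣ u′ → 𝒮 ∣ t · u ≡βΣ t′ · u′
  ·-cong p q = Eq.gmap (_· _) ·ˡ p ◅◅ Eq.gmap (_ ·_) ·ʳ q

  exts-≡ : {θ σ : Subst m n} → (∀ i → 𝒮 ∣ θ i ≡βΣ σ i) →
           ∀ i → 𝒮 ∣ exts θ i ≡βΣ exts σ i
  exts-≡ eq zero    = ε
  exts-≡ eq (suc i) = ≡-ren suc (eq i)

  sub-≡ : {θ σ : Subst m n} → (∀ i → 𝒮 ∣ θ i ≡βΣ σ i) →
          ∀ t → 𝒮 ∣ t ⟪ θ ⟫ ≡βΣ t ⟪ σ ⟫
  sub-≡ eq (con c)  = ε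
  sub-≡ eq (var i)  = eq i
  sub-≡ eq (sort s) = ε
  sub-≡ eq (Π A B)  = Π-cong (sub-≡ eq A) (sub-≡ (exts-≡ eq) B)
  sub-≡ eq (ƛ A t)  = ƛ-cong (sub-≡ eq A) (sub-≡ (exts-≡ eq) t)
  sub-≡ eq (t · u)  = ·-cong (sub-≡ eq t) (sub-≡ eq u)

  []-≡ : (t : Term (suc n)) {u v : Term n} → 𝒮 ∣ u ≡βΣ v → 𝒮 ∣ t [ u ] ≡βΣ t [ v ]
  []-≡ t eq = sub-≡ (λ { zero → eq ; (suc i) → ε }) t

-- Typing in an arbitrary signature

module _ {𝒮 : Signature} where

  ⊢ctx : {Γ : Ctx n} {t A : Term n} → 𝒮 ∣ Γ ⊢ t ∶ A → 𝒮 ⊢ Γ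
  ⊢ctx (sort ⊢Γ)      = ⊢Γ
  ⊢ctx (const ⊢Γ _ _) = ⊢Γ
  ⊢ctx (var ⊢Γ _)     = ⊢Γ
  ⊢ctx (prod ⊢A _)    = ⊢ctx ⊢A
  ⊢ctx (abs ⊢A _ _)   = ⊢ctx ⊢A
  ⊢ctx (app ⊢t _)     = ⊢ctx ⊢t
  ⊢ctx (conv ⊢t _ _)  = ⊢ctx ⊢t

  ⊢cast : {Γ : Ctx n} {t t′ A A′ : Term n} →
          t ≡ t′ → A ≡ A′ → 𝒮 ∣ Γ ⊢ t ∶ A → 𝒮 ∣ Γ ⊢ t′ ∶ A′
  ⊢cast refl refl ⊢t = ⊢t

  Renaming : Ctx n → Ctx m → (Fin m → Fin n) → Set
  Renaming Δ Γ f = ∀ i → lookup Δ (f i) ≡ ren f (lookup Γ i)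

  ext-renaming : {Δ : Ctx n} {Γ : Ctx m} {f : Fin m → Fin n} (A : Term m) →
                 Renaming Δ Γ f → Renaming (Δ ▹ ren f A) (Γ ▹ A) (ext f)
  ext-renaming A ρ zero    = sym (ren-wk _ A)
  ext-renaming A ρ (suc i) = trans (cong wk (ρ i)) (sym (ren-wk _ _))

  ⊢ren : {Γ : Ctx m} {t A : Term m} → 𝒮 ∣ Γ ⊢ t ∶ A →
         {Δ : Ctx n} {f : Fin m → Fin n} → 𝒮 ⊢ Δ → Renaming Δ Γ f →
         𝒮 ∣ Δ ⊢ ren f t ∶ ren f A
  ⊢ren (sort _) ⊢Δ ρ = sort ⊢Δ
  ⊢ren (const {A = A} _ ⊢A p) ⊢Δ ρ =
    ⊢cast refl (sym (ren-ren (λ ()) A)) (const ⊢Δ ⊢A p)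
  ⊢ren (var _ i) ⊢Δ ρ = ⊢cast refl (ρ i) (var ⊢Δ _)
  ⊢ren (prod {A = A} ⊢A ⊢B) ⊢Δ ρ =
    let ⊢A′ = ⊢ren ⊢A ⊢Δ ρ
    in prod ⊢A′ (⊢ren ⊢B (decl ⊢Δ ⊢A′) (ext-renaming A ρ))
  ⊢ren (abs {A = A} ⊢A ⊢B ⊢t) ⊢Δ ρ =
    let ⊢A′ = ⊢ren ⊢A ⊢Δ ρ
        ⊢Δ′ = decl ⊢Δ ⊢A′
        ρ′  = ext-renaming A ρ
    in abs ⊢A′ (⊢ren ⊢B ⊢Δ′ ρ′) (⊢ren ⊢t ⊢Δ′ ρ′)
  ⊢ren (app {B = B} {u = u} ⊢t ⊢u) ⊢Δ ρ =
    ⊢cast refl (sym (ren-[] _ B u)) (app (⊢ren ⊢t ⊢Δ ρ) (⊢ren ⊢u ⊢Δ ρ))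
  ⊢ren (conv ⊢t ⊢B eq) ⊢Δ ρ = conv (⊢ren ⊢t ⊢Δ ρ) (⊢ren ⊢B ⊢Δ ρ) (≡-ren _ eq)

  ⊢wk : {Γ : Ctx n} {t A B : Term n} → 𝒮 ∣ Γ ⊢ B ∶ sort TYPE →
        𝒮 ∣ Γ ⊢ t ∶ A → 𝒮 ∣ Γ ▹ B ⊢ wk t ∶ wk A
  ⊢wk ⊢B ⊢t = ⊢ren ⊢t (decl (⊢ctx ⊢B) ⊢B) (λ _ → refl)

  ⊢wk₀ : {Γ : Ctx n} {t A : Term 0} → 𝒮 ⊢ Γ → 𝒮 ∣ ∅ ⊢ t ∶ A →
         𝒮 ∣ Γ ⊢ wk₀ t ∶ wk₀ A
  ⊢wk₀ ⊢Γ ⊢t = ⊢ren ⊢t ⊢Γ (λ ())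

  ⊢lookup : {Γ : Ctx n} → 𝒮 ⊢ Γ → ∀ i → 𝒮 ∣ Γ ⊢ lookup Γ i ∶ sort TYPE
  ⊢lookup (decl ⊢Γ ⊢A) zero    = ⊢wk ⊢A ⊢A
  ⊢lookup (decl ⊢Γ ⊢A) (suc i) = ⊢wk ⊢A (⊢lookup ⊢Γ i)

  Substitution : Ctx n → Ctx m → Subst m n → Set
  Substitution Δ Γ σ = ∀ i → 𝒮 ∣ Δ ⊢ σ i ∶ lookup Γ i ⟪ σ ⟫

  exts-substitution : {Δ : Ctx n} {Γ : Ctx m} {σ : Subst m n} (A : Term m) →
    𝒮 ∣ Δ ⊢ A ⟪ σ ⟫ ∶ sort TYPE → Substitution Δ Γ σ →
    Substitution (Δ ▹ A ⟪ σ ⟫) (Γ ▹ A) (exts σ)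
  exts-substitution {σ = σ} A ⊢A ⊢σ zero =
    ⊢cast refl (sym (sub-wk σ A)) (var (decl (⊢ctx ⊢A) ⊢A) zero)
  exts-substitution {Γ = Γ} {σ} A ⊢A ⊢σ (suc i) =
    ⊢cast refl (sym (sub-wk σ (lookup Γ i))) (⊢wk ⊢A (⊢σ i))

  ⊢sub : {Γ : Ctx m} {t A : Term m} → 𝒮 ∣ Γ ⊢ t ∶ A →
         {Δ : Ctx n} {σ : Subst m n} → 𝒮 ⊢ Δ → Substitution Δ Γ σ →
         𝒮 ∣ Δ ⊢ t ⟪ σ ⟫ ∶ A ⟪ σ ⟫
  ⊢sub (sort _) ⊢Δ ⊢σ = sort ⊢Δ
  ⊢sub (const {A = A} _ ⊢A p) ⊢Δ ⊢σ =
    ⊢cast refl (trans (ren≡sub _ A) (sym (sub-ren (λ ()) A))) (const ⊢Δ ⊢A p)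
  ⊢sub (var _ i) ⊢Δ ⊢σ = ⊢σ i
  ⊢sub (prod {A = A} ⊢A ⊢B) ⊢Δ ⊢σ =
    let ⊢A′ = ⊢sub ⊢A ⊢Δ ⊢σ
    in prod ⊢A′ (⊢sub ⊢B (decl ⊢Δ ⊢A′) (exts-substitution A ⊢A′ ⊢σ))
  ⊢sub (abs {A = A} ⊢A ⊢B ⊢t) ⊢Δ ⊢σ =
    let ⊢A′ = ⊢sub ⊢A ⊢Δ ⊢σ
        ⊢Δ′ = decl ⊢Δ ⊢A′
        ⊢σ′ = exts-substitution A ⊢A′ ⊢σ
    in abs ⊢A′ (⊢sub ⊢B ⊢Δ′ ⊢σ′) (⊢sub ⊢t ⊢Δ′ ⊢σ′)
  ⊢sub (app {B = B} {u = u} ⊢t ⊢u) {σ = σ} ⊢Δ ⊢σ =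
    ⊢cast refl (sym (sub-[] σ B u)) (app (⊢sub ⊢t ⊢Δ ⊢σ) (⊢sub ⊢u ⊢Δ ⊢σ))
  ⊢sub (conv ⊢t ⊢B eq) ⊢Δ ⊢σ = conv (⊢sub ⊢t ⊢Δ ⊢σ) (⊢sub ⊢B ⊢Δ ⊢σ) (≡-sub _ eq)

  ⊢[] : {Γ : Ctx n} {A u : Term n} {t B : Term (suc n)} →
        𝒮 ∣ Γ ▹ A ⊢ t ∶ B → 𝒮 ∣ Γ ⊢ u ∶ A → 𝒮 ∣ Γ ⊢ t [ u ] ∶ B [ u ]
  ⊢[] {Γ = Γ} {A} {u} ⊢t ⊢u = ⊢sub ⊢t (⊢ctx ⊢u) λ
    { zero    → ⊢cast refl (sym (wk-[] A u)) ⊢u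
    ; (suc i) → ⊢cast refl (sym (wk-[] (lookup Γ i) u)) (var (⊢ctx ⊢u) i) }

  -- The identity substitution is well typed between the two contexts; only the last variable needs
  -- a conversion.
  ⊢convctx : {Γ : Ctx n} {A A′ : Term n} {t B : Term (suc n)} →
             𝒮 ∣ A ≡βΣ A′ → 𝒮 ∣ Γ ⊢ A ∶ sort TYPE → 𝒮 ∣ Γ ⊢ A′ ∶ sort TYPE →
             𝒮 ∣ Γ ▹ A ⊢ t ∶ B → 𝒮 ∣ Γ ▹ A′ ⊢ t ∶ B
  ⊢convctx {Γ = Γ} {A} eq ⊢A ⊢A′ ⊢t =
    ⊢cast (sub-var (λ _ → refl) _) (sub-var (λ _ → refl) _) (⊢sub ⊢t ⊢Γ′ λ
      { zero    → conv (var ⊢Γ′ zero)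
                    (⊢cast (sym (sub-var (λ _ → refl) (wk A))) refl (⊢wk ⊢A′ ⊢A))
                    (≡-ren suc (≡-sym eq)
                      ◅◅ ≡-reflexive (sym (sub-var (λ _ → refl) (wk A))))
      ; (suc i) → ⊢cast refl (sym (sub-var (λ _ → refl) _)) (var ⊢Γ′ (suc i)) })
    where ⊢Γ′ = decl (⊢ctx ⊢A′) ⊢A′

  Π⁻¹ : {Γ : Ctx n} {A T : Term n} {B : Term (suc n)} → 𝒮 ∣ Γ ⊢ Π A B ∶ T →
        𝒮 ∣ Γ ⊢ A ∶ sort TYPE × ∃ λ s → 𝒮 ∣ Γ ▹ A ⊢ B ∶ sort s
  Π⁻¹ (prod ⊢A ⊢B)  = ⊢A , _ , ⊢B
  Π⁻¹ (conv ⊢t _ _) = Π⁻¹ ⊢t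

  ƛ⁻¹ : {Γ : Ctx n} {A T : Term n} {t : Term (suc n)} → 𝒮 ∣ Γ ⊢ ƛ A t ∶ T →
        𝒮 ∣ Γ ⊢ A ∶ sort TYPE ×
        ∃ λ B → 𝒮 ∣ Γ ▹ A ⊢ t ∶ B × (∃ λ s → 𝒮 ∣ Γ ▹ A ⊢ B ∶ sort s) ×
                𝒮 ∣ Π A B ≡βΣ T
  ƛ⁻¹ (abs ⊢A ⊢B ⊢t) = ⊢A , _ , ⊢t , (_ , ⊢B) , ε
  ƛ⁻¹ (conv ⊢t _ eq) =
    let ⊢A , B , ⊢t′ , ⊢B , eq′ = ƛ⁻¹ ⊢t in ⊢A , B , ⊢t′ , ⊢B , eq′ ◅◅ eq

  ·⁻¹ : {Γ : Ctx n} {t u T : Term n} → 𝒮 ∣ Γ ⊢ t · u ∶ T →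
        ∃ λ A → (∃ λ B → 𝒮 ∣ Γ ⊢ t ∶ Π A B) × 𝒮 ∣ Γ ⊢ u ∶ A
  ·⁻¹ (app ⊢t ⊢u)   = _ , (_ , ⊢t) , ⊢u
  ·⁻¹ (conv ⊢t _ _) = ·⁻¹ ⊢t

  ⊢type : {Γ : Ctx n} {t A : Term n} → 𝒮 ∣ Γ ⊢ t ∶ A →
          A ≡ sort KIND ⊎ ∃ λ s → 𝒮 ∣ Γ ⊢ A ∶ sort s
  ⊢type (sort _) = inj₁ refl
  ⊢type (const ⊢Γ ⊢A _) = inj₂ (_ , ⊢wk₀ ⊢Γ ⊢A)
  ⊢type (var ⊢Γ i) = inj₂ (_ , ⊢lookup ⊢Γ i)
  ⊢type (prod {s = TYPE} ⊢A _) = inj₂ (_ , sort (⊢ctx ⊢A))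
  ⊢type (prod {s = KIND} _ _)  = inj₁ refl
  ⊢type (abs ⊢A ⊢B _) = inj₂ (_ , prod ⊢A ⊢B)
  ⊢type (app ⊢t ⊢u) with ⊢type ⊢t
  ... | inj₂ (_ , ⊢Π) = let _ , _ , ⊢B = Π⁻¹ ⊢Π in inj₂ (_ , ⊢[] ⊢B ⊢u)
  ⊢type (conv _ ⊢B _) = inj₂ (_ , ⊢B)

  KIND-untypable : {Γ : Ctx n} {A : Term n} → ¬ (𝒮 ∣ Γ ⊢ sort KIND ∶ A)
  KIND-untypable ⊢K = KIND-not-kf (proj₁ (typed-kf ⊢K))

  ⊢Λ : {Γ : Ctx n} {t A : Term n} → 𝒮 ∣ Γ ⊢ t ∶ A → Λ 𝒮 t
  ⊢Λ (sort _)      = sort TYPE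
  ⊢Λ (const _ _ p) = con (_ , p)
  ⊢Λ (var _ i)     = var i
  ⊢Λ (prod ⊢A ⊢B)  = Π (⊢Λ ⊢A) (⊢Λ ⊢B)
  ⊢Λ (abs ⊢A _ ⊢t) = ƛ (⊢Λ ⊢A) (⊢Λ ⊢t)
  ⊢Λ (app ⊢t ⊢u)   = ⊢Λ ⊢t · ⊢Λ ⊢u
  ⊢Λ (conv ⊢t _ _) = ⊢Λ ⊢t

  type-Λ : {Γ : Ctx n} {t A : Term n} → 𝒮 ∣ Γ ⊢ t ∶ A → Λ 𝒮 A
  type-Λ ⊢t with ⊢type ⊢t
  ... | inj₁ refl     = sort KIND
  ... | inj₂ (_ , ⊢A) = ⊢Λ ⊢A

-- Subject reduction

confluent⇒church-rosser :
  {X : Set} {_⟶_ : X → X → Set} → Confluent _⟶_ →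
  ∀ {x y} → EqClosure _⟶_ x y → ∃ λ z → Star _⟶_ x z × Star _⟶_ y z
confluent⇒church-rosser conf ε = _ , ε , ε
confluent⇒church-rosser conf (fwd s ◅ eq) =
  let _ , p , q = confluent⇒church-rosser conf eq in _ , s ◅ p , q
confluent⇒church-rosser conf (bwd s ◅ eq) =
  let _ , p , q = confluent⇒church-rosser conf eq
      _ , p′ , q′ = conf (s ◅ ε) p
  in _ , p′ , q ◅◅ q′

constHeaded-sub : {t : Term m} → ConstHeaded t → (θ : Subst m n) → ConstHeaded (t ⟪ θ ⟫)
constHeaded-sub (con c)   θ = con c
constHeaded-sub (app h u) θ = app (constHeaded-sub h θ) (u ⟪ θ ⟫)

constHeaded-isKind : {t : Term n} → ConstHeaded t → isKind t ≡ false
constHeaded-isKind (con c)   = refl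
constHeaded-isKind (app h u) = refl

module _ {𝒮 : Signature} where

  -- No rule applies at the root, because an instance of a constant-headed term is constant-headed.
  Π-↪ : {t A C : Term n} {B : Term (suc n)} → 𝒮 ∣ t ↪ C → t ≡ Π A B →
        ∃ λ A′ → ∃ λ B′ → C ≡ Π A′ B′ × 𝒮 ∣ A ↪* A′ × 𝒮 ∣ B ↪* B′
  Π-↪ (rule {h = h} _ θ) eq with subst ConstHeaded eq (constHeaded-sub h θ)
  ... | ()
  Π-↪ (Πˡ s) refl = _ , _ , refl , s ◅ ε , ε
  Π-↪ (Πʳ s) refl = _ , _ , refl , ε , s ◅ ε

  Π-↪* : {A C : Term n} {B : Term (suc n)} → 𝒮 ∣ Π A B ↪* C →
         ∃ λ A′ → ∃ λ B′ → C ≡ Π A′ B′ × 𝒮 ∣ A ↪* A′ × 𝒮 ∣ B ↪* B′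
  Π-↪* ε = _ , _ , refl , ε , ε
  Π-↪* (s ◅ r) with Π-↪ s refl
  ... | _ , _ , refl , p , q with Π-↪* r
  ... | _ , _ , eq , p′ , q′ = _ , _ , eq , p ◅◅ p′ , q ◅◅ q′

  sort-↪ : {t C : Term n} {s : Sort} → 𝒮 ∣ t ↪ C → t ≢ sort s
  sort-↪ (rule {h = h} _ θ) eq with subst ConstHeaded eq (constHeaded-sub h θ)
  ... | ()

  sort-↪* : {C : Term n} {s : Sort} → 𝒮 ∣ sort s ↪* C → C ≡ sort s
  sort-↪* ε       = refl
  sort-↪* (s ◅ _) = ⊥-elim (sort-↪ s refl)

module Theory {𝒮 : Signature} (th : IsTheory 𝒮) where
  open IsTheory th
  open Erase 𝒮 th using (erase; erase-Λ; erase-id; erase-step)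

  church-rosser : {t u : Term n} → Λ 𝒮 t → Λ 𝒮 u → 𝒮 ∣ t ≡βΣ u →
                  ∃ λ v → 𝒮 ∣ t ↪* v × 𝒮 ∣ u ↪* v
  church-rosser tΛ uΛ eq =
    let (v , _) , p , q = confluent⇒church-rosser (confluent _)
          (Eq.gmap (λ t → erase t , erase-Λ t) erase-step eq)
    in v , subst (𝒮 ∣_↪* v) (erase-id tΛ) (Star.gmap proj₁ (λ s → s) p)
         , subst (𝒮 ∣_↪* v) (erase-id uΛ) (Star.gmap proj₁ (λ s → s) q)

  -- A common reduct of two products is a product whose components are reducts of theirs. Subject
  -- reduction for β rests on this.
  Π-injective : {A A′ : Term n} {B B′ : Term (suc n)} →
                Λ 𝒮 (Π A B) → Λ 𝒮 (Π A′ B′) → 𝒮 ∣ Π A B ≡βΣ Π A′ B′ →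
                𝒮 ∣ A ≡βΣ A′ × 𝒮 ∣ B ≡βΣ B′
  Π-injective ΠΛ ΠΛ′ eq with church-rosser ΠΛ ΠΛ′ eq
  ... | _ , r , r′ with Π-↪* r | Π-↪* r′
  ... | _ , _ , refl , p , q | _ , _ , refl , p′ , q′ =
    ↪*⇒≡ p ◅◅ ≡-sym (↪*⇒≡ p′) , ↪*⇒≡ q ◅◅ ≡-sym (↪*⇒≡ q′)

  ⊢β : {Γ : Ctx n} {A A′ u : Term n} {t B : Term (suc n)} →
       𝒮 ∣ Γ ⊢ ƛ A t ∶ Π A′ B → 𝒮 ∣ Γ ⊢ u ∶ A′ → 𝒮 ∣ Γ ⊢ t [ u ] ∶ B [ u ]
  ⊢β ⊢ƛ ⊢u with ƛ⁻¹ ⊢ƛ | ⊢type ⊢ƛ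
  ... | ⊢A , _ , ⊢t , (_ , ⊢B₀) , eq | inj₂ (_ , ⊢Π)
    with Π-injective (⊢Λ (prod ⊢A ⊢B₀)) (⊢Λ ⊢Π) eq | Π⁻¹ ⊢Π
  ... | A≡A′ , B₀≡B | ⊢A′ , _ , ⊢B =
    conv (⊢[] ⊢t (conv ⊢u ⊢A (≡-sym A≡A′))) (⊢[] ⊢B ⊢u) (≡-sub _ B₀≡B)

  subject-reduction : {Γ : Ctx n} {t t′ A : Term n} →
                      𝒮 ∣ Γ ⊢ t ∶ A → 𝒮 ∣ t ↪ t′ → 𝒮 ∣ Γ ⊢ t′ ∶ A
  -- Theories preserve only types in `Λ 𝒮`; a type assigned by a derivation always is.
  subject-reduction ⊢t (rule p θ) = preserving p _ (type-Λ ⊢t) θ ⊢t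
  subject-reduction (app ⊢t ⊢u) β = ⊢β ⊢t ⊢u
  subject-reduction (prod ⊢A ⊢B) (Πˡ s) =
    let ⊢A′ = subject-reduction ⊢A s
    in prod ⊢A′ (⊢convctx (fwd s ◅ ε) ⊢A ⊢A′ ⊢B)
  subject-reduction (prod ⊢A ⊢B) (Πʳ s) = prod ⊢A (subject-reduction ⊢B s)
  subject-reduction (abs ⊢A ⊢B ⊢t) (ƛˡ s) =
    let ⊢A′ = subject-reduction ⊢A s
        to-A′ : ∀ {t C} → 𝒮 ∣ _ ▹ _ ⊢ t ∶ C → 𝒮 ∣ _ ▹ _ ⊢ t ∶ C
        to-A′ = ⊢convctx (fwd s ◅ ε) ⊢A ⊢A′
    in conv (abs ⊢A′ (to-A′ ⊢B) (to-A′ ⊢t)) (prod ⊢A ⊢B) (bwd (Πˡ s) ◅ ε)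
  subject-reduction (abs ⊢A ⊢B ⊢t) (ƛʳ s) = abs ⊢A ⊢B (subject-reduction ⊢t s)
  subject-reduction (app ⊢t ⊢u) (·ˡ s) = app (subject-reduction ⊢t s) ⊢u
  subject-reduction ⊢t·u@(app {B = B} ⊢t ⊢u) (·ʳ s) with ⊢type ⊢t
  ... | inj₂ (_ , ⊢Π) =
    let _ , _ , ⊢B = Π⁻¹ ⊢Π
    in conv (app ⊢t (subject-reduction ⊢u s)) (⊢[] ⊢B ⊢u) ([]-≡ B (bwd s ◅ ε))
  subject-reduction (conv ⊢t ⊢B eq) s@β        = conv (subject-reduction ⊢t s) ⊢B eq
  subject-reduction (conv ⊢t ⊢B eq) s@(Πˡ _)   = conv (subject-reduction ⊢t s) ⊢B eq
  subject-reduction (conv ⊢t ⊢B eq) s@(Πʳ _)   = conv (subject-reduction ⊢t s) ⊢B eq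
  subject-reduction (conv ⊢t ⊢B eq) s@(ƛˡ _)   = conv (subject-reduction ⊢t s) ⊢B eq
  subject-reduction (conv ⊢t ⊢B eq) s@(ƛʳ _)   = conv (subject-reduction ⊢t s) ⊢B eq
  subject-reduction (conv ⊢t ⊢B eq) s@(·ˡ _)   = conv (subject-reduction ⊢t s) ⊢B eq
  subject-reduction (conv ⊢t ⊢B eq) s@(·ʳ _)   = conv (subject-reduction ⊢t s) ⊢B eq

  subject-reduction* : {Γ : Ctx n} {t t′ A : Term n} →
                       𝒮 ∣ Γ ⊢ t ∶ A → 𝒮 ∣ t ↪* t′ → 𝒮 ∣ Γ ⊢ t′ ∶ A
  subject-reduction* ⊢t ε       = ⊢t
  subject-reduction* ⊢t (s ◅ r) = subject-reduction* (subject-reduction ⊢t s) r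

  type-reduction* : {Γ : Ctx n} {t A A′ : Term n} →
                    𝒮 ∣ Γ ⊢ t ∶ A → 𝒮 ∣ A ↪* A′ → 𝒮 ∣ Γ ⊢ t ∶ A′
  type-reduction* ⊢t r with ⊢type ⊢t
  ... | inj₁ refl     = ⊢cast refl (sym (sort-↪* r)) ⊢t
  ... | inj₂ (_ , ⊢A) = conv ⊢t (subject-reduction* ⊢A r) (↪*⇒≡ r)

  typed≢KIND : {Γ : Ctx n} {A T : Term n} → 𝒮 ∣ Γ ⊢ A ∶ T → ¬ (𝒮 ∣ A ≡βΣ sort KIND)
  typed≢KIND ⊢A eq with church-rosser (⊢Λ ⊢A) (sort KIND) eq
  ... | _ , p , q with sort-↪* q
  ... | refl = KIND-untypable (subject-reduction* ⊢A p)

  -- A conversion cannot lead away from `sort KIND`: its target would be a typed term convertible to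
  -- `sort KIND`.
  isKind⇒KIND : {Γ : Ctx n} {A T : Term n} → 𝒮 ∣ Γ ⊢ A ∶ T → isKind A ≡ true →
                T ≡ sort KIND
  isKind⇒KIND (sort _)         _ = refl
  isKind⇒KIND (prod _ ⊢B)      k with refl ← isKind⇒KIND ⊢B k = refl
  isKind⇒KIND (conv ⊢t ⊢B eq)  k with refl ← isKind⇒KIND ⊢t k =
    ⊥-elim (typed≢KIND ⊢B (≡-sym eq))

  -- A kind has only the type `sort KIND`, which is itself untypable. This is what keeps kinds out
  -- of substitutions.
  isKind-typed : {Γ : Ctx n} {t A T : Term n} →
                 𝒮 ∣ Γ ⊢ t ∶ A → 𝒮 ∣ Γ ⊢ A ∶ T → isKind t ≡ false
  isKind-typed {t = t} ⊢t ⊢A with isKind t in eq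
  ... | false = refl
  ... | true with refl ← isKind⇒KIND ⊢t eq = ⊥-elim (KIND-untypable ⊢A)

  sort-unique : {Γ : Ctx n} {A : Term n} →
                𝒮 ∣ Γ ⊢ A ∶ sort TYPE → ¬ (𝒮 ∣ Γ ⊢ A ∶ sort KIND)
  sort-unique ⊢T ⊢K with isKind⇒KIND ⊢T (isKind-KIND ⊢K)
  ... | ()

  -- A common reduct inherits both sorts. In the conversion case it ensures that the old and the new
  -- type fall under the same clause of the theorem.
  ≡-sort : {Γ : Ctx n} {A B : Term n} {s s′ : Sort} → 𝒮 ∣ Γ ⊢ A ∶ sort s →
           𝒮 ∣ Γ ⊢ B ∶ sort s′ → 𝒮 ∣ A ≡βΣ B → s ≡ s′
  ≡-sort {s = s} {s′} ⊢A ⊢B eq with church-rosser (⊢Λ ⊢A) (⊢Λ ⊢B) eq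
  ... | C , p , q = go (subject-reduction* ⊢A p) (subject-reduction* ⊢B q)
    where
    go : ∀ {s s′} → 𝒮 ∣ _ ⊢ C ∶ sort s → 𝒮 ∣ _ ⊢ C ∶ sort s′ → s ≡ s′
    go {TYPE} {TYPE} _ _  = refl
    go {TYPE} {KIND} p q  = ⊥-elim (sort-unique p q)
    go {KIND} {TYPE} p q  = ⊥-elim (sort-unique q p)
    go {KIND} {KIND} _ _  = refl

-- Type inference by computation over the prelude

module Checker (𝕋 : PreludeTheory) where
  open PreludeTheory 𝕋 renaming (signature to 𝒯)
  open Theory isTheory
  open Erase 𝒯 isTheory using (_≟_)

  infix 4 _≟ₜ_
  _≟ₜ_ : (t u : Term n) → Maybe (t ≡ u)
  con c       ≟ₜ con d       = map (cong con) (dec⇒maybe (c ≟ d))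
  var i       ≟ₜ var j       = map (cong var) (dec⇒maybe (i Fin.≟ j))
  sort TYPE   ≟ₜ sort TYPE   = just refl
  sort KIND   ≟ₜ sort KIND   = just refl
  Π A B       ≟ₜ Π A′ B′     = do
    p ← A ≟ₜ A′
    q ← B ≟ₜ B′
    just (cong₂ Π p q)
  ƛ A t       ≟ₜ ƛ A′ t′     = do
    p ← A ≟ₜ A′
    q ← t ≟ₜ t′
    just (cong₂ ƛ p q)
  (t · u)     ≟ₜ (t′ · u′)   = do
    p ← t ≟ₜ t′
    q ← u ≟ₜ u′
    just (cong₂ _·_ p q)
  _           ≟ₜ _           = nothing

  pattern skip₄ p = there (there (there (there p)))

  declaration : (c : Prelude) → ∃ λ A → decl (pre c) A ∈ 𝒯
  declaration set = _ , here refl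
  declaration o   = _ , there (here refl)
  declaration el  = _ , there (there (here refl))
  declaration prf = _ , there (there (there (here refl)))
  declaration arr = _ , skip₄ (here refl)
  declaration imp = _ , skip₄ (there (here refl))
  declaration pi  = _ , skip₄ (there (there (here refl)))
  declaration all = _ , skip₄ (there (there (there (here refl))))

  arguments : Term n → Term n → Subst 2 n
  arguments a b zero    = b
  arguments a b (suc _) = a

  contract : (t u : Term n) → Maybe (∃ λ v → 𝒯 ∣ t · u ↪ v)
  contract (ƛ A t) u = just (t [ u ] , β)
  contract (con (pre el)) (con (pre arr) · a · b) =
    just (_ , rule (skip₄ (skip₄ (here refl))) (arguments a b))
  contract (con (pre prf)) (con (pre imp) · a · b) =
    just (_ , rule (skip₄ (skip₄ (there (here refl)))) (arguments a b))
  contract (con (pre el)) (con (pre pi) · a · b) =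
    just (_ , rule (skip₄ (skip₄ (there (there (here refl))))) (arguments a b))
  contract (con (pre prf)) (con (pre all) · a · b) =
    just (_ , rule (skip₄ (skip₄ (there (there (there (here refl)))))) (arguments a b))
  contract _ _ = nothing

  Reduct : Term n → Set
  Reduct t = ∃ λ u → 𝒯 ∣ t ↪* u

  -- Innermost evaluation: function and argument are normalised before their application is
  -- contracted, and only contractions consume fuel. The reduction sequence is returned along with
  -- the result, so nothing has to be proved about the evaluator.
  normalise : ℕ → (t : Term n) → Reduct t
  normalise-· : ℕ → {t u : Term n} → Reduct t → Reduct u → Reduct (t · u)

  normalise k (con c)  = con c , ε
  normalise k (var i)  = var i , ε
  normalise k (sort s) = sort s , ε
  normalise k (Π A B)  =
    let A′ , p = normalise k A
        B′ , q = normalise k B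
    in Π A′ B′ , Star.gmap (λ A → Π A B) Πˡ p ◅◅ Star.gmap (Π A′) Πʳ q
  normalise k (ƛ A t)  =
    let A′ , p = normalise k A
        t′ , q = normalise k t
    in ƛ A′ t′ , Star.gmap (λ A → ƛ A t) ƛˡ p ◅◅ Star.gmap (ƛ A′) ƛʳ q
  normalise zero (t · u)    = t · u , ε
  normalise (suc k) (t · u) = normalise-· k (normalise (suc k) t) (normalise (suc k) u)

  normalise-· k {u = u} (t′ , p) (u′ , q) = go (contract t′ u′)
    where
    r = Star.gmap (_· u) ·ˡ p ◅◅ Star.gmap (t′ ·_) ·ʳ q
    go : Maybe (∃ λ v → 𝒯 ∣ t′ · u′ ↪ v) → Reduct _
    go nothing        = t′ · u′ , r
    go (just (v , s)) = let w , r′ = normalise k v in w , r ◅◅ s ◅ r′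

  -- Enough for every reduction below to reach a normal form; if it were not,
  -- the checks would fail rather than be unsound.
  fuel : ℕ
  fuel = 100

  convert : (t u : Term n) → Maybe (𝒯 ∣ t ≡βΣ u)
  convert t u =
    let t′ , p = normalise fuel t
        u′ , q = normalise fuel u
    in do
      eq ← t′ ≟ₜ u′
      just (↪*⇒≡ p ◅◅ ≡-reflexive eq ◅◅ ≡-sym (↪*⇒≡ q))

  -- The sort of `B` is read off the derivation for `t`, which saves a second inference on `B`.
  ⊢ƛ : {Γ : Ctx n} {A : Term n} {t B : Term (suc n)} → B ≢ sort KIND →
       𝒯 ∣ Γ ⊢ A ∶ sort TYPE → 𝒯 ∣ Γ ▹ A ⊢ t ∶ B → 𝒯 ∣ Γ ⊢ ƛ A t ∶ Π A B
  ⊢ƛ B≢K ⊢A ⊢t with ⊢type ⊢t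
  ... | inj₁ B≡K      = ⊥-elim (B≢K B≡K)
  ... | inj₂ (_ , ⊢B) = abs ⊢A ⊢B ⊢t

  ⊢app : {Γ : Ctx n} {A A′ t u : Term n} {B : Term (suc n)} → 𝒯 ∣ A′ ≡βΣ A →
         𝒯 ∣ Γ ⊢ t ∶ Π A B → 𝒯 ∣ Γ ⊢ u ∶ A′ → 𝒯 ∣ Γ ⊢ t · u ∶ B [ u ]
  ⊢app eq ⊢t ⊢u with ⊢type ⊢t
  ... | inj₂ (_ , ⊢Π) = app ⊢t (conv ⊢u (proj₁ (Π⁻¹ ⊢Π)) eq)

  not-KIND : (B : Term n) → Maybe (B ≢ sort KIND)
  not-KIND (sort KIND) = nothing
  not-KIND (sort TYPE) = just λ ()
  not-KIND (con _)     = just λ ()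
  not-KIND (var _)     = just λ ()
  not-KIND (Π _ _)     = just λ ()
  not-KIND (ƛ _ _)     = just λ ()
  not-KIND (_ · _)     = just λ ()

  Inferred : Ctx n → Term n → Set
  Inferred Γ t = ∃ λ A → 𝒯 ∣ Γ ⊢ t ∶ A

  normal-type : {Γ : Ctx n} {t : Term n} → Inferred Γ t → Inferred Γ t
  normal-type (A , ⊢t) =
    let A′ , r = normalise fuel A in A′ , type-reduction* ⊢t r

  to-sort : {Γ : Ctx n} {A : Term n} → Inferred Γ A → Maybe (∃ λ s → 𝒯 ∣ Γ ⊢ A ∶ sort s)
  to-sort i with normal-type i
  ... | sort s , ⊢A = just (s , ⊢A)
  ... | _           = nothing

  -- The fuel bounds the nesting of constants in the types of constants.
  infer : ℕ → (Γ : Ctx n) → 𝒯 ⊢ Γ → (t : Term n) → Maybe (Inferred Γ t)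
  infer (suc k) Γ ⊢Γ (con (pre c)) = do
    (s , ⊢A) ← infer k ∅ empty (proj₁ (declaration c)) >>= to-sort
    just (_ , const ⊢Γ ⊢A (proj₂ (declaration c)))
  infer k Γ ⊢Γ (var i)     = just (_ , var ⊢Γ i)
  infer k Γ ⊢Γ (sort TYPE) = just (_ , sort ⊢Γ)
  infer k Γ ⊢Γ (Π A B)     = do
    (TYPE , ⊢A) ← infer k Γ ⊢Γ A >>= to-sort
      where _ → nothing
    (s , ⊢B)    ← infer k (Γ ▹ A) (decl ⊢Γ ⊢A) B >>= to-sort
    just (sort s , prod ⊢A ⊢B)
  infer k Γ ⊢Γ (ƛ A t)     = do
    (TYPE , ⊢A) ← infer k Γ ⊢Γ A >>= to-sort
      where _ → nothing
    (B , ⊢t)    ← infer k (Γ ▹ A) (decl ⊢Γ ⊢A) t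
    B≢K         ← not-KIND B
    just (Π A B , ⊢ƛ B≢K ⊢A ⊢t)
  infer k Γ ⊢Γ (t · u)     = do
    (Π A B , ⊢t) ← map normal-type (infer k Γ ⊢Γ t)
      where _ → nothing
    (A′ , ⊢u)    ← infer k Γ ⊢Γ u
    eq           ← convert A′ A
    just (B [ u ] , ⊢app eq ⊢t ⊢u)
  infer _ _ _ _ = nothing

  check : (t A : Term 0) → Maybe (𝒯 ∣ ∅ ⊢ t ∶ A)
  check t A = do
    -- The bound 10 leaves room: the longest chain of constants through their types has four
    -- members, from `imp` or `pi` through `prf` and `el` to `set`.
    (s , ⊢A) ← infer 10 ∅ empty A >>= to-sort
    (A′ , ⊢t) ← infer 10 ∅ empty t
    eq ← convert A′ A
    just (conv ⊢t ⊢A eq)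

-- Soundness of the prelude parameters

module PreludeSound (𝕋 : PreludeTheory) (other* other⁺ : ℕ → Term 0) where
  open PreludeTheory 𝕋 renaming (signature to 𝒯)
  open Checker 𝕋
  open Translation other* other⁺

  -- Merges the two forms that the type of a plus translation can take. The choice is by shape, so
  -- that it can be computed from a bare declaration.
  relates : Term n → Term (n * 2) → Term (n * 2)
  relates A t = if isKind A then A ⁺⟨ t ⟩ else (A ⁺ · t)

  Sound : Entry → Set
  Sound (decl c A)   = 𝒯 ∣ ∅ ⊢ con* c ∶ A ⋆ × 𝒯 ∣ ∅ ⊢ con⁺ c ∶ relates A (con* c)
  Sound (rule ℓ r _) = 𝒯 ∣ ℓ ⋆ ≡βΣ r ⋆ × 𝒯 ∣ ℓ ⁺ ≡βΣ r ⁺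

  sound? : (e : Entry) → Maybe (Sound e)
  sound? (decl c A) = do
    p ← check (con* c) (A ⋆)
    q ← check (con⁺ c) (relates A (con* c))
    just (p , q)
  sound? (rule ℓ r _) = do
    p ← convert (ℓ ⋆) (r ⋆)
    q ← convert (ℓ ⁺) (r ⁺)
    just (p , q)

  sounds? : ∀ es → Maybe (All Sound es)
  sounds? []       = just []
  sounds? (e ∷ es) = do
    p  ← sound? e
    ps ← sounds? es
    just (p ∷ ps)

  -- The check evaluates although 𝕋 is a variable: every declaration and rule it looks up lies in
  -- the concrete prefix `Σpre`, and no entry of `Σpre` mentions an `other` constant.
  prelude-sound : All Sound Σpre
  prelude-sound = to-witness-T (sounds? Σpre) _

-- Kinds and substitution

isKind-ren : (f : Fin m → Fin n) (t : Term m) → isKind (ren f t) ≡ isKind t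
isKind-ren f (con c)     = refl
isKind-ren f (var i)     = refl
isKind-ren f (sort TYPE) = refl
isKind-ren f (sort KIND) = refl
isKind-ren f (Π A B)     = isKind-ren (ext f) B
isKind-ren f (ƛ A t)     = refl
isKind-ren f (t · u)     = refl

-- No variable of t is replaced by a kind, so that isKind gives the same
-- answer on the subterms of t before and after substitution.
Stable : Subst m n → Term m → Set
Stable θ (con c)  = ⊤
Stable θ (var i)  = isKind (θ i) ≡ false
Stable θ (sort s) = ⊤
Stable θ (Π A B)  = Stable θ A × Stable (exts θ) B
Stable θ (ƛ A t)  = Stable θ A × Stable (exts θ) t
Stable θ (t · u)  = Stable θ t × Stable θ u

isKind-sub : {θ : Subst m n} (t : Term m) → Stable θ t → isKind (t ⟪ θ ⟫) ≡ isKind t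
isKind-sub (con c)     _        = refl
isKind-sub (var i)     eq       = eq
isKind-sub (sort TYPE) _        = refl
isKind-sub (sort KIND) _        = refl
isKind-sub (Π A B)     (_ , st) = isKind-sub B st
isKind-sub (ƛ A t)     _        = refl
isKind-sub (t · u)     _        = refl

stable : {θ : Subst m n} → (∀ i → isKind (θ i) ≡ false) → (t : Term m) → Stable θ t
stable eq (con c)  = _
stable eq (var i)  = eq i
stable eq (sort s) = _
stable {θ = θ} eq (Π A B) = stable eq A , stable (λ
  { zero → refl ; (suc i) → trans (isKind-ren suc (θ i)) (eq i) }) B
stable {θ = θ} eq (ƛ A t) = stable eq A , stable (λ
  { zero → refl ; (suc i) → trans (isKind-ren suc (θ i)) (eq i) }) t
stable eq (t · u)  = stable eq t , stable eq u

data SortFree {n} : Term n → Set where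
  con : ∀ c → SortFree (con c)
  var : ∀ i → SortFree (var i)
  Π   : ∀ {A B} → SortFree A → SortFree B → SortFree (Π A B)
  ƛ   : ∀ {A t} → SortFree A → SortFree t → SortFree (ƛ A t)
  _·_ : ∀ {t u} → SortFree t → SortFree u → SortFree (t · u)

sortFree⇒¬isKind : {t : Term n} → SortFree t → isKind t ≡ false
sortFree⇒¬isKind (con c) = refl
sortFree⇒¬isKind (var i) = refl
sortFree⇒¬isKind (Π A B) = sortFree⇒¬isKind B
sortFree⇒¬isKind (ƛ A t) = refl
sortFree⇒¬isKind (t · u) = refl

-- Each occurrence of a variable in `t` leaves its image as a subterm of the instance. Variables of
-- the scope that do not occur in `t` are left unconstrained, which is why `Stable` refers to `t`.
sortFree⇒stable : {θ : Subst m n} (t : Term m) → SortFree (t ⟪ θ ⟫) → Stable θ t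
sortFree⇒stable (con c) _       = _
sortFree⇒stable (var i) sf      = sortFree⇒¬isKind sf
sortFree⇒stable (Π A B) (Π p q) = sortFree⇒stable A p , sortFree⇒stable B q
sortFree⇒stable (ƛ A t) (ƛ p q) = sortFree⇒stable A p , sortFree⇒stable t q
sortFree⇒stable (t · u) (p · q) = sortFree⇒stable t p , sortFree⇒stable u q

module _ {𝒮 : Signature} (th : IsTheory 𝒮) where
  open Theory th

  -- `TYPE` occurs in typed terms only as the final codomain of a kind. Domains, bodies of
  -- abstractions and both parts of an application have types that are themselves typed, so none of
  -- them is a kind.
  typed-sortFree : {Γ : Ctx n} {t A : Term n} → 𝒮 ∣ Γ ⊢ t ∶ A → isKind t ≡ false →
                   SortFree t
  typed-sortFree (const _ _ _) _ = con _
  typed-sortFree (var _ i)     _ = var i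
  typed-sortFree (prod ⊢A ⊢B)  k =
    Π (typed-sortFree ⊢A (isKind-typed ⊢A (sort (⊢ctx ⊢A)))) (typed-sortFree ⊢B k)
  typed-sortFree (abs ⊢A ⊢B ⊢t) k =
    ƛ (typed-sortFree ⊢A (isKind-typed ⊢A (sort (⊢ctx ⊢A))))
      (typed-sortFree ⊢t (isKind-typed ⊢t ⊢B))
  typed-sortFree (app ⊢t ⊢u) k with ⊢type ⊢t
  ... | inj₂ (_ , ⊢Π) =
    typed-sortFree ⊢t (isKind-typed ⊢t ⊢Π) ·
    typed-sortFree ⊢u (isKind-typed ⊢u (proj₁ (Π⁻¹ ⊢Π)))
  typed-sortFree (conv ⊢t _ _) k = typed-sortFree ⊢t k

pair : Term n → Term n → Subst (suc (suc n)) n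
pair a b zero          = b
pair a b (suc zero)    = a
pair a b (suc (suc i)) = var i

pair-sub : (a b : Term n) (t : Term (suc (suc n))) →
           t ⟪ exts (single a) ⟫ [ b ] ≡ t ⟪ pair a b ⟫
pair-sub a b = sub-sub λ
  { zero → refl ; (suc zero) → wk-[] a b ; (suc (suc i)) → refl }

-- The translations commute with renaming and substitution

suc² : Fin n → Fin (suc (suc n))
suc² i = suc (suc i)

-- In the λ form of the plus translation of a product, `B ⁺` sits below `x*` and `x⁺` and is renamed
-- by `ext (ext suc)` to make room for `f` beneath them.
ren-ext²-suc : (ρ : Fin m → Fin n) (t : Term (suc (suc m))) →
               ren (ext (ext suc)) (ren (ext (ext ρ)) t) ≡
               ren (ext (ext (ext ρ))) (ren (ext (ext suc)) t)
ren-ext²-suc ρ t = trans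
  (ren-ren {h = λ i → ext (ext (ext ρ)) (ext (ext suc) i)}
    (λ { zero → refl ; (suc zero) → refl ; (suc (suc i)) → refl }) t)
  (sym (ren-ren (λ _ → refl) t))

sub-ext²-suc : (σ : Subst m n) (t : Term (suc (suc m))) →
               ren (ext (ext suc)) (t ⟪ exts (exts σ) ⟫) ≡
               ren (ext (ext suc)) t ⟪ exts (exts (exts σ)) ⟫
sub-ext²-suc σ t = trans
  (ren-sub {τ = λ i → exts (exts (exts σ)) (ext (ext suc) i)}
    (λ { zero → refl ; (suc zero) → refl
       ; (suc (suc i)) → trans (ren-wk _ (wk (σ i))) (cong wk (ren-wk suc (σ i))) }) t)
  (sym (sub-ren (λ _ → refl) t))

module Commutation (other* other⁺ : ℕ → Term 0) where
  open Translation other* other⁺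

  -- A relation rather than a function from `f` to `ρ`: it passes under binders pointwise, with no
  -- equality between functions to establish.
  record Doubles (ρ : Fin (m * 2) → Fin (n * 2)) (f : Fin m → Fin n) : Set where
    constructor doubles
    field at : ∀ i → ρ (i *ᵛ) ≡ f i *ᵛ × ρ (i ⁺ᵛ) ≡ f i ⁺ᵛ

  ext-doubles : {ρ : Fin (m * 2) → Fin (n * 2)} {f : Fin m → Fin n} →
                Doubles ρ f → Doubles (ext (ext ρ)) (ext f)
  ext-doubles (doubles d) = doubles λ
    { zero    → refl , refl
    ; (suc i) → cong suc² (proj₁ (d i)) , cong suc² (proj₂ (d i)) }

  wk²-ren : (ρ : Fin m → Fin n) (t : Term m) →
            wk (wk (ren ρ t)) ≡ ren (ext (ext ρ)) (wk (wk t))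
  wk²-ren ρ t = sym (trans (ren-wk (ext ρ) (wk t)) (cong wk (ren-wk ρ t)))

  ren-⋆ : {ρ : Fin (m * 2) → Fin (n * 2)} {f : Fin m → Fin n} → Doubles ρ f →
          (t : Term m) → ren f t ⋆ ≡ ren ρ (t ⋆)
  ren-⁺ : {ρ : Fin (m * 2) → Fin (n * 2)} {f : Fin m → Fin n} → Doubles ρ f →
          (t : Term m) (X : Term (m * 2)) → ren f t ⁺⟨ ren ρ X ⟩ ≡ ren ρ (t ⁺⟨ X ⟩)
  ren-dom : {ρ : Fin (m * 2) → Fin (n * 2)} {f : Fin m → Fin n} → Doubles ρ f →
            (A : Term m) → wk (ren f A ⁺) · var 0F ≡ ren (ext ρ) (wk (A ⁺) · var 0F)

  ren-⋆ d (con c)  = sym (ren-ren (λ ()) (con* c))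
  ren-⋆ (doubles d) (var i) = cong var (sym (proj₁ (d i)))
  ren-⋆ d (sort s) = refl
  ren-⋆ d (Π A B)  =
    cong₂ Π (ren-⋆ d A) (cong₂ Π (ren-dom d A) (ren-⋆ (ext-doubles d) B))
  ren-⋆ d (ƛ A t)  =
    cong₂ ƛ (ren-⋆ d A) (cong₂ ƛ (ren-dom d A) (ren-⋆ (ext-doubles d) t))
  ren-⋆ d (t · u)  = cong₂ _·_ (cong₂ _·_ (ren-⋆ d t) (ren-⋆ d u)) (ren-⁺ d u _)

  ren-⁺ d (con c)     X = sym (ren-ren (λ ()) (con⁺ c))
  ren-⁺ (doubles d) (var i) X = cong var (sym (proj₂ (d i)))
  ren-⁺ d (sort TYPE) X = refl
  ren-⁺ d (sort KIND) X = refl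
  ren-⁺ d (ƛ A t)     X =
    cong₂ ƛ (ren-⋆ d A) (cong₂ ƛ (ren-dom d A) (ren-⁺ (ext-doubles d) t _))
  ren-⁺ d (t · u)     X =
    cong₂ _·_ (cong₂ _·_ (ren-⁺ d t _) (ren-⋆ d u)) (ren-⁺ d u _)
  ren-⁺ {ρ = ρ} {f} d (Π A B) X rewrite isKind-ren (ext f) B with isKind B
  ... | true  =
    cong₂ Π (ren-⋆ d A) (cong₂ Π (ren-dom d A)
      (trans (cong (λ Y → ren (ext f) B ⁺⟨ Y · var 1F · var 0F ⟩) (wk²-ren ρ X))
             (ren-⁺ (ext-doubles d) B _)))
  ... | false =
    cong₂ ƛ (cong₂ Π (ren-⋆ d A) (cong₂ Π (ren-dom d A) (ren-⋆ (ext-doubles d) B)))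
      (cong₂ Π (trans (cong wk (ren-⋆ d A)) (sym (ren-wk ρ (A ⋆))))
      (cong₂ Π (cong (_· var 0F)
                 (trans (cong (wk ∘ wk) (ren-⁺ d A _)) (wk²-ren ρ (A ⁺))))
               (cong (_· (var 2F · var 1F · var 0F))
                 (trans (cong (ren (ext (ext suc))) (ren-⁺ (ext-doubles d) B _))
                   (ren-ext²-suc ρ (B ⁺))))))

  ren-dom {ρ = ρ} d A = cong (_· var 0F)
    (trans (cong wk (ren-⁺ d A _)) (sym (ren-wk ρ (A ⁺))))

  wk-⋆ : (t : Term n) → wk t ⋆ ≡ wk (wk (t ⋆))
  wk-⋆ t = trans (ren-⋆ {ρ = suc²} (doubles λ _ → refl , refl) t)
                 (sym (ren-ren (λ _ → refl) (t ⋆)))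

  wk-⁺ : (t : Term n) → wk t ⁺ ≡ wk (wk (t ⁺))
  wk-⁺ t = trans (ren-⁺ {ρ = suc²} (doubles λ _ → refl , refl) t _)
                 (sym (ren-ren (λ _ → refl) (t ⁺)))

  wk₀-⋆ : (t : Term 0) → wk₀ {n} t ⋆ ≡ wk₀ (t ⋆)
  wk₀-⋆ t = ren-⋆ (doubles λ ()) t

  -- Mediates between `t ⁺`, whose placeholder is fixed to `KIND`, and the arbitrary fillings that
  -- arise when `t` is substituted into a kind or compared by `_≈_`.
  placeholder-unused : (t : Term n) {X Y : Term (n * 2)} → isKind t ≡ false →
                       t ⁺⟨ X ⟩ ≡ t ⁺⟨ Y ⟩
  placeholder-unused (con c)     _ = refl
  placeholder-unused (var i)     _ = refl
  placeholder-unused (sort KIND) _ = refl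
  placeholder-unused (Π A B)     k rewrite k = refl
  placeholder-unused (ƛ A t)     _ = refl
  placeholder-unused (t · u)     _ = refl

  record Doublesˢ (σ : Subst (m * 2) (n * 2)) (θ : Subst m n) : Set where
    constructor doubles
    field at : ∀ i → σ (i *ᵛ) ≡ θ i ⋆ × σ (i ⁺ᵛ) ≡ θ i ⁺

  exts-doubles : {σ : Subst (m * 2) (n * 2)} {θ : Subst m n} →
                 Doublesˢ σ θ → Doublesˢ (exts (exts σ)) (exts θ)
  exts-doubles {θ = θ} (doubles d) = doubles λ
    { zero    → refl , refl
    ; (suc i) → trans (cong (wk ∘ wk) (proj₁ (d i))) (sym (wk-⋆ (θ i))) ,
                trans (cong (wk ∘ wk) (proj₂ (d i))) (sym (wk-⁺ (θ i))) }

  wk²-sub : (σ : Subst m n) (t : Term m) →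
            wk (wk (t ⟪ σ ⟫)) ≡ wk (wk t) ⟪ exts (exts σ) ⟫
  wk²-sub σ t = sym (trans (sub-wk (exts σ) (wk t)) (cong wk (sub-wk σ t)))

  sub-⋆ : {σ : Subst (m * 2) (n * 2)} {θ : Subst m n} → Doublesˢ σ θ →
          (t : Term m) → Stable θ t → (t ⟪ θ ⟫) ⋆ ≡ t ⋆ ⟪ σ ⟫
  sub-⁺ : {σ : Subst (m * 2) (n * 2)} {θ : Subst m n} → Doublesˢ σ θ →
          (t : Term m) → Stable θ t → (X : Term (m * 2)) →
          (t ⟪ θ ⟫) ⁺⟨ X ⟪ σ ⟫ ⟩ ≡ t ⁺⟨ X ⟩ ⟪ σ ⟫
  sub-dom : {σ : Subst (m * 2) (n * 2)} {θ : Subst m n} → Doublesˢ σ θ →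
            (A : Term m) → Stable θ A →
            wk ((A ⟪ θ ⟫) ⁺) · var 0F ≡ (wk (A ⁺) · var 0F) ⟪ exts σ ⟫

  sub-⋆ d (con c)  _        = trans (ren≡sub _ (con* c)) (sym (sub-ren (λ ()) (con* c)))
  sub-⋆ (doubles d) (var i) _ = sym (proj₁ (d i))
  sub-⋆ d (sort s) _        = refl
  sub-⋆ d (Π A B)  (p , q)  =
    cong₂ Π (sub-⋆ d A p) (cong₂ Π (sub-dom d A p) (sub-⋆ (exts-doubles d) B q))
  sub-⋆ d (ƛ A t)  (p , q)  =
    cong₂ ƛ (sub-⋆ d A p) (cong₂ ƛ (sub-dom d A p) (sub-⋆ (exts-doubles d) t q))
  sub-⋆ d (t · u)  (p , q)  =
    cong₂ _·_ (cong₂ _·_ (sub-⋆ d t p) (sub-⋆ d u q)) (sub-⁺ d u q _)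

  sub-⁺ d (con c)     _ X = trans (ren≡sub _ (con⁺ c)) (sym (sub-ren (λ ()) (con⁺ c)))
  -- The left side fills `θ i` with `X ⟪ σ ⟫`, the right side with `KIND`; they agree because
  -- stability says that `θ i` is not a kind.
  sub-⁺ {θ = θ} (doubles d) (var i) k X =
    trans (placeholder-unused (θ i) k) (sym (proj₂ (d i)))
  sub-⁺ d (sort TYPE) _ X =
    refl
  sub-⁺ d (sort KIND) _ X = refl
  sub-⁺ d (ƛ A t) (p , q) X =
    cong₂ ƛ (sub-⋆ d A p) (cong₂ ƛ (sub-dom d A p) (sub-⁺ (exts-doubles d) t q _))
  sub-⁺ d (t · u) (p , q) X =
    cong₂ _·_ (cong₂ _·_ (sub-⁺ d t p _) (sub-⋆ d u q)) (sub-⁺ d u q _)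
  -- Stability makes both sides take the same branch of the plus translation.
  sub-⁺ {σ = σ} {θ} d (Π A B) (p , q) X rewrite isKind-sub B q with isKind B
  ... | true  =
    cong₂ Π (sub-⋆ d A p) (cong₂ Π (sub-dom d A p)
      (trans (cong (λ Y → (B ⟪ exts θ ⟫) ⁺⟨ Y · var 1F · var 0F ⟩) (wk²-sub σ X))
             (sub-⁺ (exts-doubles d) B q _)))
  ... | false =
    cong₂ ƛ (cong₂ Π (sub-⋆ d A p) (cong₂ Π (sub-dom d A p) (sub-⋆ (exts-doubles d) B q)))
      (cong₂ Π (trans (cong wk (sub-⋆ d A p)) (sym (sub-wk σ (A ⋆))))
      (cong₂ Π (cong (_· var 0F)
                 (trans (cong (wk ∘ wk) (sub-⁺ d A p _)) (wk²-sub σ (A ⁺))))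
               (cong (_· (var 2F · var 1F · var 0F))
                 (trans (cong (ren (ext (ext suc))) (sub-⁺ (exts-doubles d) B q _))
                   (sub-ext²-suc σ (B ⁺))))))

  sub-dom {σ = σ} d A p = cong (_· var 0F)
    (trans (cong wk (sub-⁺ d A p _)) (sym (sub-wk σ (A ⁺))))

  double : (θ : Subst m n) → Subst (m * 2) (n * 2)
  double {suc m} θ zero          = θ zero ⁺
  double {suc m} θ (suc zero)    = θ zero ⋆
  double {suc m} θ (suc (suc j)) = double (θ ∘ suc) j

  double-doubles : (θ : Subst m n) → Doublesˢ (double θ) θ
  double-doubles θ = doubles (go θ)
    where
    go : ∀ {m n} (θ : Subst m n) i →
         double θ (i *ᵛ) ≡ θ i ⋆ × double θ (i ⁺ᵛ) ≡ θ i ⁺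
    go θ zero    = refl , refl
    go θ (suc i) = go (θ ∘ suc) i

  pair-doubles : (u : Term n) → Doublesˢ (pair (u ⋆) (u ⁺)) (single u)
  pair-doubles u = doubles λ { zero → refl , refl ; (suc i) → refl , refl }

-- Typing with doubled binders

infixl 8 _·²

_·² : Term n → Term (suc (suc n))
t ·² = wk (wk t) · var 1F · var 0F

-- The shape of (Π(x:A).B)⁺ for B : TYPE.
graph : (a : Term n) (d : Term (suc n)) (b q : Term (suc (suc n))) → Term n
graph a d b q =
  ƛ (Π a (Π d b)) (Π (wk a) (Π (ren (ext suc) d)
    (ren (ext (ext suc)) q · (var 2F · var 1F · var 0F))))

wk²-pair : (a b t : Term n) → wk (wk t) ⟪ pair a b ⟫ ≡ t
wk²-pair a b t = trans (sub-ren (λ _ → refl) (wk t))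
  (trans (sub-ren (λ _ → refl) t) (sub-var (λ _ → refl) t))

module _ {𝒮 : Signature} where

  ⊢dom : {Δ : Ctx n} {a p : Term n} → 𝒮 ∣ Δ ⊢ a ∶ sort TYPE →
         𝒮 ∣ Δ ⊢ p ∶ a ⟶ sort TYPE → 𝒮 ∣ Δ ▹ a ⊢ wk p · var 0F ∶ sort TYPE
  ⊢dom ⊢a ⊢p = app (⊢wk ⊢a ⊢p) (var (decl (⊢ctx ⊢a) ⊢a) 0F)

  ⊢·² : {Δ : Ctx n} {a t : Term n} {d : Term (suc n)} {b : Term (suc (suc n))} →
        𝒮 ∣ Δ ⊢ a ∶ sort TYPE → 𝒮 ∣ Δ ▹ a ⊢ d ∶ sort TYPE →
        𝒮 ∣ Δ ⊢ t ∶ Π a (Π d b) → 𝒮 ∣ Δ ▹ a ▹ d ⊢ t ·² ∶ b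
  ⊢·² {a = a} {d = d} {b} ⊢a ⊢d ⊢t = ⊢cast refl b≡
    (app (app (⊢wk ⊢d (⊢wk ⊢a ⊢t)) (var ⊢Δ 1F))
         (⊢cast refl d≡ (var ⊢Δ 0F)))
    where
    ⊢Δ = decl (⊢ctx ⊢d) ⊢d
    d≡ : wk d ≡ ren (ext suc) (ren (ext suc) d) [ var 1F ]
    d≡ = trans (ren≡sub suc d) (sym (trans
      (sub-ren (λ _ → refl) (ren (ext suc) d))
      (sub-ren (λ { zero → refl ; (suc i) → refl }) d)))
    b≡ : ren (ext (ext suc)) (ren (ext (ext suc)) b) ⟪ exts (single (var 1F)) ⟫ [ var 0F ]
         ≡ b
    b≡ = trans (pair-sub (var 1F) (var 0F) (ren (ext (ext suc)) (ren (ext (ext suc)) b)))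
      (trans (sub-ren (λ _ → refl) (ren (ext (ext suc)) b))
      (trans (sub-ren (λ { zero → refl ; (suc zero) → refl ; (suc (suc i)) → refl }) b)
             (sub-var (λ _ → refl) b)))

  ⊢app² : {Δ : Ctx n} {a p t u v : Term n} {b : Term (suc (suc n))} →
          𝒮 ∣ Δ ⊢ t ∶ Π a (Π (wk p · var 0F) b) → 𝒮 ∣ Δ ⊢ u ∶ a → 𝒮 ∣ Δ ⊢ v ∶ p · u →
          𝒮 ∣ Δ ⊢ t · u · v ∶ b ⟪ pair u v ⟫
  ⊢app² {p = p} {u = u} {v} {b} ⊢t ⊢u ⊢v = ⊢cast refl (pair-sub u v b)
    (app (app ⊢t ⊢u) (⊢cast refl (cong (_· u) (sym (wk-[] p u))) ⊢v))

  ⊢graph : {Δ : Ctx n} {a : Term n} {d : Term (suc n)} {b q : Term (suc (suc n))} →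
           𝒮 ∣ Δ ⊢ a ∶ sort TYPE → 𝒮 ∣ Δ ▹ a ⊢ d ∶ sort TYPE →
           𝒮 ∣ Δ ▹ a ▹ d ⊢ b ∶ sort TYPE → 𝒮 ∣ Δ ▹ a ▹ d ⊢ q ∶ b ⟶ sort TYPE →
           𝒮 ∣ Δ ⊢ graph a d b q ∶ Π a (Π d b) ⟶ sort TYPE
  ⊢graph {Δ = Δ} {a} {d} {b} ⊢a ⊢d ⊢b ⊢q =
    abs ⊢F (sort ⊢Δ)
      (prod ⊢a′ (prod ⊢d′
        (app (⊢ren ⊢q (decl ⊢Δa ⊢d′) (ext-renaming {𝒮 = 𝒮} {Γ = Δ ▹ a} d ρa))
             (⊢·² ⊢a′ ⊢d′ (var ⊢Δ 0F)))))
    where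
    ρa : Renaming {𝒮 = 𝒮} (Δ ▹ Π a (Π d b) ▹ wk a) (Δ ▹ a) (ext suc)
    ρa = ext-renaming {𝒮 = 𝒮} {Γ = Δ} a (λ _ → refl)
    ⊢F  = prod ⊢a (prod ⊢d ⊢b)
    ⊢Δ  = decl (⊢ctx ⊢a) ⊢F
    ⊢a′ = ⊢wk ⊢F ⊢a
    ⊢Δa = decl ⊢Δ ⊢a′
    ⊢d′ = ⊢ren ⊢d ⊢Δa ρa

  -- Turns `(Π A B) ⁺ · t`, which is an application, into a genuine product type. Abstraction uses
  -- the step backwards, application forwards.
  graph-β : (a t : Term n) (d : Term (suc n)) (b q : Term (suc (suc n))) →
            𝒮 ∣ graph a d b q · t ↪ Π a (Π d (q · (t ·²)))
  graph-β a t d b q = subst (𝒮 ∣ graph a d b q · t ↪_)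
    (cong₂ Π (wk-[] a t) (cong₂ Π
      (trans (sub-ren (λ { zero → refl ; (suc i) → refl }) d) (sub-var (λ _ → refl) d))
      (cong (_· (t ·²)) (trans
        (sub-ren (λ { zero → refl ; (suc zero) → refl ; (suc (suc i)) → refl }) q)
        (sub-var (λ _ → refl) q)))))
    β

  ƛƛ-sub : (a : Term n) (d : Term (suc n)) (t : Term (suc (suc n))) (u v : Term n) →
           𝒮 ∣ ƛ a (ƛ d t) · u · v ≡βΣ t ⟪ pair u v ⟫
  ƛƛ-sub a d t u v = fwd (·ˡ β) ◅ fwd β ◅ ≡-reflexive (pair-sub u v t)

  ƛƛ-·² : (a : Term n) (d : Term (suc n)) (t : Term (suc (suc n))) →
          𝒮 ∣ ƛ a (ƛ d t) ·² ≡βΣ t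
  ƛƛ-·² a d t = ƛƛ-sub _ _ (ren (ext (ext suc)) (ren (ext (ext suc)) t)) (var 1F) (var 0F)
    ◅◅ ≡-reflexive (trans (sub-ren (λ _ → refl) (ren (ext (ext suc)) t))
      (trans (sub-ren (λ { zero → refl ; (suc zero) → refl ; (suc (suc i)) → refl }) t)
             (sub-var (λ _ → refl) t)))

  dom-≡ : {p p′ : Term n} → 𝒮 ∣ p ≡βΣ p′ →
          𝒮 ∣ wk p · var 0F ≡βΣ wk p′ · var 0F
  dom-≡ eq = ·-cong (≡-ren suc eq) ε

-- The fundamental lemma

module Fundamental (𝕊 𝕋 : PreludeTheory) (I : Interpretation 𝕊 𝕋) where
  open PreludeTheory
  open Interpretation I
  open Commutation other* other⁺
  open PreludeSound 𝕋 other* other⁺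
  module 𝕊 = Theory (isTheory 𝕊)
  module 𝕋 = Theory (isTheory 𝕋)

  S T : Signature
  S = signature 𝕊
  T = signature 𝕋

  Π⁺-TYPE : (A : Term n) (B : Term (suc n)) (X : Term (n * 2)) → isKind B ≡ false →
            Π A B ⁺⟨ X ⟩ ≡ graph (A ⋆) (wk (A ⁺) · var 0F) (B ⋆) (B ⁺)
  Π⁺-TYPE A B X k rewrite k =
    cong (λ d → ƛ (Π A B ⋆) (Π (wk (A ⋆)) (Π (d · var 0F) _))) (sym (ren-wk suc (A ⁺)))

  Π⁺-KIND : (A : Term n) (B : Term (suc n)) (X : Term (n * 2)) → isKind B ≡ true →
            Π A B ⁺⟨ X ⟩ ≡ Π (A ⋆) (Π (wk (A ⁺) · var 0F) (B ⁺⟨ X ·² ⟩))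
  Π⁺-KIND A B X k rewrite k = refl

  placeholder-≡ : (t : Term n) {X Y : Term (n * 2)} → T ∣ X ≡βΣ Y →
                  T ∣ t ⁺⟨ X ⟩ ≡βΣ t ⁺⟨ Y ⟩
  placeholder-≡ (con c)     eq = ε
  placeholder-≡ (var i)     eq = ε
  placeholder-≡ (sort TYPE) eq = Π-cong eq ε
  placeholder-≡ (sort KIND) eq = ε
  placeholder-≡ (ƛ A t)     eq = ε
  placeholder-≡ (t · u)     eq = ε
  placeholder-≡ (Π A B)     eq with isKind B
  ... | true  = Π-cong ε (Π-cong ε (placeholder-≡ B
                  (·-cong (·-cong (≡-ren suc (≡-ren suc eq)) ε) ε)))
  ... | false = ε

  sound : ∀ {e} → e ∈ S → Sound e
  sound p with ∈-++⁻ Σpre p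
  ... | inj₁ q = All.lookup prelude-sound q
  -- By `small`, a constant outside the prelude has a type of sort `TYPE`, so `relates` takes the
  -- form of an application.
  sound {decl c A}   p | inj₂ q = con*-typed q , ⊢cast refl
    (cong (λ b → if b then A ⁺⟨ con* c ⟩ else (A ⁺ · con* c))
      (sym (isKind-TYPE (isTheory 𝕊) (small 𝕊 q)))) (con⁺-typed q)
  sound {rule ℓ r h} p | inj₂ q = rule* q , rule⁺ q

  -- Typed reduction and conversion under the translations

  infix 4 _≈_

  -- `eq⁺` ranges over all `X` because the codomain of a kind product is filled with a term other
  -- than the filling of the product itself.
  record _≈_ (t u : Term n) : Set where
    constructor _,_
    field
      eq* : T ∣ t ⋆ ≡βΣ u ⋆
      eq⁺ : ∀ X → T ∣ t ⁺⟨ X ⟩ ≡βΣ u ⁺⟨ X ⟩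

  ≈-trans : {t u v : Term n} → t ≈ u → u ≈ v → t ≈ v
  ≈-trans (p , q) (p′ , q′) = p ◅◅ p′ , λ X → q X ◅◅ q′ X

  ≈-sym : {t u : Term n} → t ≈ u → u ≈ t
  ≈-sym (p , q) = ≡-sym p , λ X → ≡-sym (q X)

  -- If the shapes of the codomains differed, one plus translation would be a λ and the other a Π.
  ≈-Π : {A A′ : Term n} {B B′ : Term (suc n)} → isKind B ≡ isKind B′ →
        A ≈ A′ → B ≈ B′ → Π A B ≈ Π A′ B′
  ≈-Π {A = A} {A′} {B} {B′} k (p , p⁺) (q , q⁺) = Π-cong p (Π-cong (dom-≡ (p⁺ _)) q) , go k
    where
    go : isKind B ≡ isKind B′ → ∀ X → T ∣ Π A B ⁺⟨ X ⟩ ≡βΣ Π A′ B′ ⁺⟨ X ⟩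
    go k X with isKind B | isKind B′ | k
    ... | true  | _ | refl = Π-cong p (Π-cong (dom-≡ (p⁺ _)) (q⁺ _))
    ... | false | _ | refl =
      ƛ-cong (Π-cong p (Π-cong (dom-≡ (p⁺ _)) q))
        (Π-cong (≡-ren suc p) (Π-cong (dom-≡ (≡-ren suc (p⁺ _)))
          (·-cong (≡-ren (ext (ext suc)) (q⁺ _)) ε)))

  ≈-ƛ : {A A′ : Term n} {t t′ : Term (suc n)} → A ≈ A′ → t ≈ t′ → ƛ A t ≈ ƛ A′ t′
  ≈-ƛ (p , p⁺) (q , q⁺) =
    ƛ-cong p (ƛ-cong (dom-≡ (p⁺ _)) q) , λ _ → ƛ-cong p (ƛ-cong (dom-≡ (p⁺ _)) (q⁺ _))

  ≈-· : {t t′ u u′ : Term n} → t ≈ t′ → u ≈ u′ → t · u ≈ t′ · u′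
  ≈-· (p , p⁺) (q , q⁺) =
    ·-cong (·-cong p q) (q⁺ _) , λ _ → ·-cong (·-cong (p⁺ _) q) (q⁺ _)

  ≈-refl : {t : Term n} → t ≈ t
  ≈-refl = ε , λ _ → ε

  -- Every variable of ℓ or r occurs in the well-typed terms ℓ θ or r θ,
  -- neither of which is a kind, so that θ is stable on both sides.
  rule-≈ : ∀ {Γ : Ctx n} {A} {ℓ r : Term k} {h} → rule ℓ r h ∈ S → (θ : Subst k n) →
           S ∣ Γ ⊢ ℓ ⟪ θ ⟫ ∶ A → ℓ ⟪ θ ⟫ ≈ r ⟪ θ ⟫
  rule-≈ {n = n} {ℓ = ℓ} {r} {h} p θ ⊢ℓ = commute* , commute⁺
    where
    ⊢r = 𝕊.subject-reduction ⊢ℓ (rule p θ)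
    ℓ-sf : SortFree (ℓ ⟪ θ ⟫)
    ℓ-sf = typed-sortFree (isTheory 𝕊) ⊢ℓ (constHeaded-isKind (constHeaded-sub h θ))
    ¬kind : isKind (r ⟪ θ ⟫) ≡ false
    ¬kind with isKind (r ⟪ θ ⟫) in eq
    ... | false = refl
    -- A kind on the right would have type `sort KIND`. By subject reduction this is also the type
    -- of the left-hand instance, which would then be a kind despite being sort-free.
    ... | true with refl ← 𝕊.isKind⇒KIND ⊢r eq =
      trans (sym (isKind-KIND ⊢ℓ)) (sortFree⇒¬isKind ℓ-sf)
    r-sf : SortFree (r ⟪ θ ⟫)
    r-sf = typed-sortFree (isTheory 𝕊) ⊢r ¬kind
    d = double-doubles θ
    ℓ-st = sortFree⇒stable ℓ ℓ-sf
    r-st = sortFree⇒stable r r-sf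
    commute* : T ∣ (ℓ ⟪ θ ⟫) ⋆ ≡βΣ (r ⟪ θ ⟫) ⋆
    commute* = subst₂ (T ∣_≡βΣ_) (sym (sub-⋆ d ℓ ℓ-st)) (sym (sub-⋆ d r r-st))
      (≡-sub _ (proj₁ (sound p)))
    commute⁺ : ∀ X → T ∣ (ℓ ⟪ θ ⟫) ⁺⟨ X ⟩ ≡βΣ (r ⟪ θ ⟫) ⁺⟨ X ⟩
    commute⁺ X = subst₂ (T ∣_≡βΣ_)
      (trans (sym (sub-⁺ d ℓ ℓ-st _)) (placeholder-unused (ℓ ⟪ θ ⟫) (sortFree⇒¬isKind ℓ-sf)))
      (trans (sym (sub-⁺ d r r-st _)) (placeholder-unused (r ⟪ θ ⟫) ¬kind))
      (≡-sub _ (proj₂ (sound p)))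

  single-stable : ∀ {Γ : Ctx n} {A u s} (t : Term (suc n)) →
                  S ∣ Γ ⊢ u ∶ A → S ∣ Γ ⊢ A ∶ sort s → Stable (single u) t
  single-stable t ⊢u ⊢A =
    stable (λ { zero → 𝕊.isKind-typed ⊢u ⊢A ; (suc i) → refl }) t

  -- One source step becomes two target steps, for `x*` and `x⁺`. Typing makes `u` a non-kind, hence
  -- the substitution stable, and makes the contractum a non-kind, hence independent of `X`.
  β-≈ : ∀ {Γ : Ctx n} {A u T} {t : Term (suc n)} → S ∣ Γ ⊢ ƛ A t · u ∶ T →
        ƛ A t · u ≈ t [ u ]
  β-≈ {A = A} {u} {t = t} ⊢t·u with ·⁻¹ ⊢t·u
  ... | _ , (_ , ⊢ƛ) , ⊢u with ⊢type ⊢ƛ | ƛ⁻¹ ⊢ƛ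
  ... | inj₂ (_ , ⊢Π) | _ , _ , ⊢t , (_ , ⊢B) , _ =
      (ƛƛ-sub _ _ (t ⋆) (u ⋆) (u ⁺) ◅◅ ≡-reflexive (sym (sub-⋆ (pair-doubles u) t st)))
    , λ X → ƛƛ-sub _ _ (t ⁺) (u ⋆) (u ⁺) ◅◅ ≡-reflexive
        (trans (sym (sub-⁺ (pair-doubles u) t st _))
               (placeholder-unused (t [ u ])
                 (trans (isKind-sub t st) (𝕊.isKind-typed ⊢t ⊢B))))
    where st = single-stable t ⊢u (proj₁ (Π⁻¹ ⊢Π))

  -- Typing is essential: `ƛ A (var 0F) · sort TYPE` reduces to `sort TYPE` and so changes shape.
  -- For typed terms the sort determines the shape, and subject reduction keeps the sort.
  ↪-isKind : ∀ {Γ : Ctx n} {B B′ s} → S ∣ Γ ⊢ B ∶ sort s → S ∣ B ↪ B′ →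
             isKind B ≡ isKind B′
  ↪-isKind {s = TYPE} ⊢B st = trans (isKind-TYPE (isTheory 𝕊) ⊢B)
    (sym (isKind-TYPE (isTheory 𝕊) (𝕊.subject-reduction ⊢B st)))
  ↪-isKind {s = KIND} ⊢B st = trans (isKind-KIND ⊢B)
    (sym (isKind-KIND (𝕊.subject-reduction ⊢B st)))

  ↪-≈ : ∀ {Γ : Ctx n} {t t′ A} → S ∣ Γ ⊢ t ∶ A → S ∣ t ↪ t′ → t ≈ t′
  ↪-≈ ⊢t β          = β-≈ ⊢t
  ↪-≈ ⊢t (rule p θ) = rule-≈ p θ ⊢t
  ↪-≈ ⊢t (Πˡ s) = ≈-Π refl (↪-≈ (proj₁ (Π⁻¹ ⊢t)) s) ≈-refl
  ↪-≈ ⊢t (Πʳ s) =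
    let _ , _ , ⊢B = Π⁻¹ ⊢t in ≈-Π (↪-isKind ⊢B s) ≈-refl (↪-≈ ⊢B s)
  ↪-≈ ⊢t (ƛˡ s) = ≈-ƛ (↪-≈ (proj₁ (ƛ⁻¹ ⊢t)) s) ≈-refl
  ↪-≈ ⊢t (ƛʳ s) = let _ , _ , ⊢b , _ = ƛ⁻¹ ⊢t in ≈-ƛ ≈-refl (↪-≈ ⊢b s)
  ↪-≈ ⊢t (·ˡ s) = let _ , (_ , ⊢f) , _ = ·⁻¹ ⊢t in ≈-· (↪-≈ ⊢f s) ≈-refl
  ↪-≈ ⊢t (·ʳ s) = let _ , _ , ⊢u = ·⁻¹ ⊢t in ≈-· ≈-refl (↪-≈ ⊢u s)

  ↪*-≈ : ∀ {Γ : Ctx n} {t t′ A} → S ∣ Γ ⊢ t ∶ A → S ∣ t ↪* t′ → t ≈ t′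
  ↪*-≈ ⊢t ε       = ≈-refl
  ↪*-≈ ⊢t (s ◅ r) = ≈-trans (↪-≈ ⊢t s) (↪*-≈ (𝕊.subject-reduction ⊢t s) r)

  ≡-≈ : ∀ {Γ : Ctx n} {A B T U} → S ∣ Γ ⊢ A ∶ T → S ∣ Γ ⊢ B ∶ U → S ∣ A ≡βΣ B → A ≈ B
  ≡-≈ ⊢A ⊢B eq =
    let _ , p , q = 𝕊.church-rosser (⊢Λ ⊢A) (⊢Λ ⊢B) eq
    in ≈-trans (↪*-≈ ⊢A p) (≈-sym (↪*-≈ ⊢B q))

  -- The cases of the induction on derivations

  -- The clauses are proved together because they feed one another: well-formedness of translated
  -- contexts uses `kind`, products of sort `KIND` use `KIND⁺`, and application uses `type` for its
  -- argument.
  record Translated (Γ : Ctx n) (t A : Term n) : Set where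
    field
      star : T ∣ Γ ⋆⁺ ⊢ t ⋆ ∶ A ⋆
      type : S ∣ Γ ⊢ A ∶ sort TYPE → T ∣ Γ ⋆⁺ ⊢ t ⁺ ∶ A ⁺ · t ⋆
      kind : S ∣ Γ ⊢ A ∶ sort KIND → T ∣ Γ ⋆⁺ ⊢ t ⁺ ∶ A ⁺⟨ t ⋆ ⟩
      KIND⁺ : A ≡ sort KIND → ∀ X → T ∣ Γ ⋆⁺ ⊢ X ∶ t ⋆ →
              T ∣ Γ ⋆⁺ ⊢ t ⁺⟨ X ⟩ ∶ sort KIND

  open Translated

  module _ {Γ : Ctx n} where

    -- Besides `star`, only one clause has content for a given `A`: its sort is unique, and
    -- `sort KIND` has no type.
    typed : ∀ {t A} → T ∣ Γ ⋆⁺ ⊢ t ⋆ ∶ A ⋆ → T ∣ Γ ⋆⁺ ⊢ t ⁺ ∶ A ⁺ · t ⋆ →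
            S ∣ Γ ⊢ A ∶ sort TYPE → Translated Γ t A
    typed ⊢* ⊢⁺ ⊢A = record
      { star  = ⊢*
      ; type  = λ _ → ⊢⁺
      ; kind  = λ ⊢K → ⊥-elim (𝕊.sort-unique ⊢A ⊢K)
      ; KIND⁺ = λ { refl → ⊥-elim (KIND-untypable ⊢A) } }

    kinded : ∀ {t A} → T ∣ Γ ⋆⁺ ⊢ t ⋆ ∶ A ⋆ → T ∣ Γ ⋆⁺ ⊢ t ⁺ ∶ A ⁺⟨ t ⋆ ⟩ →
             S ∣ Γ ⊢ A ∶ sort KIND → Translated Γ t A
    kinded ⊢* ⊢⁺ ⊢A = record
      { star  = ⊢*
      ; type  = λ ⊢T → ⊥-elim (𝕊.sort-unique ⊢T ⊢A)
      ; kind  = λ _ → ⊢⁺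
      ; KIND⁺ = λ { refl → ⊥-elim (KIND-untypable ⊢A) } }

    is-kind : ∀ {t} → T ∣ Γ ⋆⁺ ⊢ t ⋆ ∶ sort KIND →
              (∀ X → T ∣ Γ ⋆⁺ ⊢ X ∶ t ⋆ → T ∣ Γ ⋆⁺ ⊢ t ⁺⟨ X ⟩ ∶ sort KIND) →
              Translated Γ t (sort KIND)
    is-kind ⊢* ⊢⁺ = record
      { star  = ⊢*
      ; type  = ⊥-elim ∘ KIND-untypable
      ; kind  = ⊥-elim ∘ KIND-untypable
      ; KIND⁺ = λ _ → ⊢⁺ }

    -- This is clause `kind` for `A ∶ sort TYPE`, since `TYPE⁺` filled with `A ⋆` is
    -- `A ⋆ ⟶ sort TYPE`.
    predicate : ∀ {A} → S ⊢ Γ → Translated Γ A (sort TYPE) →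
                T ∣ Γ ⋆⁺ ⊢ A ⁺ ∶ A ⋆ ⟶ sort TYPE
    predicate ⊢Γ ⟦A⟧ = kind ⟦A⟧ (sort ⊢Γ)

    domain : ∀ {A} → S ⊢ Γ → Translated Γ A (sort TYPE) →
             T ∣ Γ ⋆⁺ ▹ A ⋆ ⊢ wk (A ⁺) · var 0F ∶ sort TYPE
    domain ⊢Γ ⟦A⟧ = ⊢dom (star ⟦A⟧) (predicate ⊢Γ ⟦A⟧)

  module _ {Γ : Ctx n} where

    ⊢Π⋆ : ∀ {A B s} → S ⊢ Γ → Translated Γ A (sort TYPE) →
          Translated (Γ ▹ A) B (sort s) → T ∣ Γ ⋆⁺ ⊢ Π A B ⋆ ∶ sort s
    ⊢Π⋆ ⊢Γ ⟦A⟧ ⟦B⟧ = prod (star ⟦A⟧) (prod (domain ⊢Γ ⟦A⟧) (star ⟦B⟧))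

    ⊢Π⁺ : ∀ {A B} → S ∣ Γ ⊢ A ∶ sort TYPE → S ∣ Γ ▹ A ⊢ B ∶ sort TYPE →
          Translated Γ A (sort TYPE) → Translated (Γ ▹ A) B (sort TYPE) →
          T ∣ Γ ⋆⁺ ⊢ Π A B ⁺ ∶ Π A B ⋆ ⟶ sort TYPE
    ⊢Π⁺ {A} {B} ⊢A ⊢B ⟦A⟧ ⟦B⟧ =
      ⊢cast (sym (Π⁺-TYPE A B _ (isKind-TYPE (isTheory 𝕊) ⊢B))) refl
        (⊢graph (star ⟦A⟧) (domain (⊢ctx ⊢A) ⟦A⟧) (star ⟦B⟧) (predicate (⊢ctx ⊢B) ⟦B⟧))

    translated-prod : ∀ {A B s} → S ∣ Γ ⊢ A ∶ sort TYPE → S ∣ Γ ▹ A ⊢ B ∶ sort s →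
      Translated Γ A (sort TYPE) → Translated (Γ ▹ A) B (sort s) →
      Translated Γ (Π A B) (sort s)
    translated-prod {s = TYPE} ⊢A ⊢B ⟦A⟧ ⟦B⟧ =
      kinded (⊢Π⋆ (⊢ctx ⊢A) ⟦A⟧ ⟦B⟧) (⊢Π⁺ ⊢A ⊢B ⟦A⟧ ⟦B⟧) (sort (⊢ctx ⊢A))
    translated-prod {A} {B} {s = KIND} ⊢A ⊢B ⟦A⟧ ⟦B⟧ =
      is-kind (⊢Π⋆ (⊢ctx ⊢A) ⟦A⟧ ⟦B⟧) λ X ⊢X →
        ⊢cast (sym (Π⁺-KIND A B X (isKind-KIND ⊢B))) refl
          (prod (star ⟦A⟧) (prod dom (KIND⁺ ⟦B⟧ refl (X ·²) (⊢·² (star ⟦A⟧) dom ⊢X))))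
      where dom = domain (⊢ctx ⊢A) ⟦A⟧

    translated-abs : ∀ {A B t s} → S ∣ Γ ⊢ A ∶ sort TYPE → S ∣ Γ ▹ A ⊢ B ∶ sort s →
      Translated Γ A (sort TYPE) → Translated (Γ ▹ A) B (sort s) →
      Translated (Γ ▹ A) t B → Translated Γ (ƛ A t) (Π A B)
    translated-abs {A} {B} {t} {s} ⊢A ⊢B ⟦A⟧ ⟦B⟧ ⟦t⟧ = go s refl
      where
      dom = domain (⊢ctx ⊢A) ⟦A⟧
      ⊢ƛ⋆ : T ∣ Γ ⋆⁺ ⊢ ƛ A t ⋆ ∶ Π A B ⋆
      ⊢ƛ⋆ = abs (star ⟦A⟧) (prod dom (star ⟦B⟧)) (abs dom (star ⟦B⟧) (star ⟦t⟧))
      go : ∀ s′ → s ≡ s′ → Translated Γ (ƛ A t) (Π A B)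
      -- The abstraction rule yields the codomain `B ⁺ · t ⋆`, while unfolding `(Π A B) ⁺ · ƛ A t ⋆`
      -- yields `B ⁺ · (ƛ A t ⋆ ·²)`. A β-expansion inside the codomain, followed by `graph-β`
      -- backwards, closes the gap.
      go TYPE refl = typed ⊢ƛ⋆ (conv
          (abs (star ⟦A⟧) (prod dom ⊢Bt) (abs dom ⊢Bt (type ⟦t⟧ ⊢B)))
          (app (⊢Π⁺ ⊢A ⊢B ⟦A⟧ ⟦B⟧) ⊢ƛ⋆)
          (Π-cong ε (Π-cong ε (·-cong ε (≡-sym (ƛƛ-·² _ _ (t ⋆)))))
            ◅◅ bwd (graph-β _ _ _ _ _) ◅ ≡-reflexive
                 (cong (_· ƛ A t ⋆) (sym (Π⁺-TYPE A B _ (isKind-TYPE (isTheory 𝕊) ⊢B))))))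
        (prod ⊢A ⊢B)
        where
        ⊢Bt : T ∣ (Γ ▹ A) ⋆⁺ ⊢ B ⁺ · t ⋆ ∶ sort TYPE
        ⊢Bt = app (predicate (⊢ctx ⊢B) ⟦B⟧) (star ⟦t⟧)
      -- The same β-expansion takes place within the placeholder of `B`.
      go KIND refl = kinded ⊢ƛ⋆ (⊢cast refl
          (sym (Π⁺-KIND A B (ƛ A t ⋆) (isKind-KIND ⊢B)))
          (abs (star ⟦A⟧) (prod dom ⊢BX) (abs dom ⊢BX
            (conv (kind ⟦t⟧ ⊢B) ⊢BX (placeholder-≡ B (≡-sym (ƛƛ-·² _ _ (t ⋆))))))))
        (prod ⊢A ⊢B)
        where
        ⊢BX : T ∣ (Γ ▹ A) ⋆⁺ ⊢ B ⁺⟨ ƛ A t ⋆ ·² ⟩ ∶ sort KIND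
        ⊢BX = KIND⁺ ⟦B⟧ refl _ (⊢·² (star ⟦A⟧) dom ⊢ƛ⋆)

    translated-app : ∀ {A B t u} → S ∣ Γ ⊢ t ∶ Π A B → S ∣ Γ ⊢ u ∶ A →
      Translated Γ t (Π A B) → Translated Γ u A → Translated Γ (t · u) (B [ u ])
    translated-app {A} {B} {t} {u} ⊢t ⊢u ⟦t⟧ ⟦u⟧ with ⊢type ⊢t
    ... | inj₂ (_ , ⊢Π) = go (proj₁ (proj₂ (Π⁻¹ ⊢Π))) (proj₂ (proj₂ (Π⁻¹ ⊢Π)))
      where
      ⊢A = proj₁ (Π⁻¹ ⊢Π)
      st = single-stable B ⊢u ⊢A
      apply : ∀ {v b} → T ∣ Γ ⋆⁺ ⊢ v ∶ Π (A ⋆) (Π (wk (A ⁺) · var 0F) b) →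
              T ∣ Γ ⋆⁺ ⊢ v · u ⋆ · u ⁺ ∶ b ⟪ pair (u ⋆) (u ⁺) ⟫
      apply ⊢v = ⊢app² ⊢v (star ⟦u⟧) (type ⟦u⟧ ⊢A)
      ⊢* : T ∣ Γ ⋆⁺ ⊢ (t · u) ⋆ ∶ (B [ u ]) ⋆
      ⊢* = ⊢cast refl (sym (sub-⋆ (pair-doubles u) B st)) (apply (star ⟦t⟧))
      ·²-pair : (t ⋆ ·²) ⟪ pair (u ⋆) (u ⁺) ⟫ ≡ (t · u) ⋆
      ·²-pair = cong (λ v → v · u ⋆ · u ⁺) (wk²-pair _ _ (t ⋆))
      go : ∀ s → S ∣ Γ ▹ A ⊢ B ∶ sort s → Translated Γ (t · u) (B [ u ])
      go TYPE ⊢B = typed ⊢*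
        (⊢cast refl (cong₂ _·_ (sym (sub-⁺ (pair-doubles u) B st _)) ·²-pair)
          -- Reducing the type, instead of converting it, yields well-formedness of the exposed
          -- product along the way.
          (apply (𝕋.type-reduction* (⊢cast refl
            (cong (_· t ⋆) (Π⁺-TYPE A B _ (isKind-TYPE (isTheory 𝕊) ⊢B)))
            (type ⟦t⟧ (prod ⊢A ⊢B))) (graph-β _ _ _ _ _ ◅ ε))))
        (⊢[] ⊢B ⊢u)
      go KIND ⊢B = kinded ⊢*
        (⊢cast refl (trans (sym (sub-⁺ (pair-doubles u) B st _))
                           (cong ((B [ u ]) ⁺⟨_⟩) ·²-pair))
          (apply (⊢cast refl (Π⁺-KIND A B (t ⋆) (isKind-KIND ⊢B))
            (kind ⟦t⟧ (prod ⊢A ⊢B)))))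
        (⊢[] ⊢B ⊢u)

    translated-conv : ∀ {A B t s} → S ∣ Γ ⊢ t ∶ A → S ∣ Γ ⊢ B ∶ sort s → S ∣ A ≡βΣ B →
      Translated Γ t A → Translated Γ B (sort s) → Translated Γ t B
    translated-conv {A} {B} {t} {s} ⊢t ⊢B eq ⟦t⟧ ⟦B⟧ with ⊢type ⊢t
    ... | inj₁ refl = ⊥-elim (𝕊.typed≢KIND ⊢B (≡-sym eq))
    -- With equal sorts, the clause known for `A` is the one required for `B`, and `_≈_` relates the
    -- two types.
    ... | inj₂ (_ , ⊢A) with 𝕊.≡-sort ⊢A ⊢B eq | ≡-≈ ⊢A ⊢B eq
    ... | refl | eq* , eq⁺ = go s refl
      where
      ⊢* : T ∣ Γ ⋆⁺ ⊢ t ⋆ ∶ B ⋆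
      ⊢* = conv (star ⟦t⟧) (star ⟦B⟧) eq*
      go : ∀ s′ → s ≡ s′ → Translated Γ t B
      go TYPE refl = typed ⊢*
        (conv (type ⟦t⟧ ⊢A) (app (predicate (⊢ctx ⊢B) ⟦B⟧) ⊢*) (·-cong (eq⁺ _) ε)) ⊢B
      go KIND refl = kinded ⊢*
        (conv (kind ⟦t⟧ ⊢A) (KIND⁺ ⟦B⟧ refl (t ⋆) ⊢*) (eq⁺ _)) ⊢B

  module _ {n} {Γ : Ctx n} where

    translated-const : ∀ {c A s} → S ⊢ Γ → T ⊢ Γ ⋆⁺ → S ∣ ∅ ⊢ A ∶ sort s → decl c A ∈ S →
      Translated Γ (con c) (wk₀ A)
    translated-const {c} {A} {s} ⊢Γ ⊢Γ⋆⁺ ⊢A p = go s refl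
      where
      ⊢* : T ∣ Γ ⋆⁺ ⊢ con {n} c ⋆ ∶ wk₀ {n} A ⋆
      ⊢* = ⊢cast refl (sym (wk₀-⋆ A)) (⊢wk₀ ⊢Γ⋆⁺ (proj₁ (sound p)))
      relates-≡ : ∀ {b} → isKind A ≡ b →
                  relates A (con* c) ≡ (if b then A ⁺⟨ con* c ⟩ else (A ⁺ · con* c))
      relates-≡ refl = refl
      ⊢⁺ : ∀ {b} → isKind A ≡ b → T ∣ Γ ⋆⁺ ⊢ con {n} c ⁺ ∶
             wk₀ (if b then A ⁺⟨ con* c ⟩ else (A ⁺ · con* c))
      ⊢⁺ k = ⊢wk₀ ⊢Γ⋆⁺ (⊢cast refl (relates-≡ k) (proj₂ (sound p)))
      go : ∀ s′ → s ≡ s′ → Translated Γ (con c) (wk₀ A)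
      go TYPE refl = typed ⊢*
        (⊢cast refl (cong (_· con {n} c ⋆) (sym (ren-⁺ {n = n} (doubles λ ()) A _)))
          (⊢⁺ (isKind-TYPE (isTheory 𝕊) ⊢A)))
        (⊢wk₀ ⊢Γ ⊢A)
      go KIND refl = kinded ⊢*
        (⊢cast refl (sym (ren-⁺ {n = n} (doubles λ ()) A _)) (⊢⁺ (isKind-KIND ⊢A)))
        (⊢wk₀ ⊢Γ ⊢A)

  lookup-⋆ : (Γ : Ctx n) (i : Fin n) → lookup (Γ ⋆⁺) (i *ᵛ) ≡ lookup Γ i ⋆
  lookup-⋆ (Γ ▹ A) zero    = sym (wk-⋆ A)
  lookup-⋆ (Γ ▹ A) (suc i) =
    trans (cong (wk ∘ wk) (lookup-⋆ Γ i)) (sym (wk-⋆ (lookup Γ i)))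

  lookup-⁺ : (Γ : Ctx n) (i : Fin n) →
             lookup (Γ ⋆⁺) (i ⁺ᵛ) ≡ lookup Γ i ⁺ · var (i *ᵛ)
  lookup-⁺ (Γ ▹ A) zero    = cong (_· var 1F) (sym (wk-⁺ A))
  lookup-⁺ (Γ ▹ A) (suc i) = trans (cong (wk ∘ wk) (lookup-⁺ Γ i))
    (cong (_· var (suc i *ᵛ)) (sym (wk-⁺ (lookup Γ i))))

  translate-ctx : {Γ : Ctx n} → S ⊢ Γ → T ⊢ Γ ⋆⁺
  translate : {Γ : Ctx n} {t A : Term n} → S ∣ Γ ⊢ t ∶ A → Translated Γ t A

  translate-ctx empty        = empty
  translate-ctx (decl ⊢Γ ⊢A) =
    let ⟦A⟧ = translate ⊢A
    in decl (decl (translate-ctx ⊢Γ) (star ⟦A⟧)) (domain ⊢Γ ⟦A⟧)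

  translate (sort {Γ = Γ} ⊢Γ) = is-kind {Γ = Γ} (sort (translate-ctx ⊢Γ))
    λ X ⊢X → prod ⊢X (sort (decl (translate-ctx ⊢Γ) ⊢X))
  translate (const {Γ = Γ} ⊢Γ ⊢A p) =
    translated-const {Γ = Γ} ⊢Γ (translate-ctx ⊢Γ) ⊢A p
  translate (var {Γ = Γ} ⊢Γ i) = typed {Γ = Γ}
    (⊢cast refl (lookup-⋆ Γ i) (var (translate-ctx ⊢Γ) (i *ᵛ)))
    (⊢cast refl (lookup-⁺ Γ i) (var (translate-ctx ⊢Γ) (i ⁺ᵛ)))
    (⊢lookup ⊢Γ i)
  translate (prod ⊢A ⊢B)    = translated-prod ⊢A ⊢B (translate ⊢A) (translate ⊢B)
  translate (abs ⊢A ⊢B ⊢t)  =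
    translated-abs ⊢A ⊢B (translate ⊢A) (translate ⊢B) (translate ⊢t)
  translate (app ⊢t ⊢u)     = translated-app ⊢t ⊢u (translate ⊢t) (translate ⊢u)
  translate (conv ⊢t ⊢B eq) = translated-conv ⊢t ⊢B eq (translate ⊢t) (translate ⊢B)

theorem1 :
  (𝕊 𝕋 : PreludeTheory) (I : Interpretation 𝕊 𝕋) →
  let open Interpretation I
      S = PreludeTheory.signature 𝕊
      T = PreludeTheory.signature 𝕋
  in
    (∀ {n} {Γ : Ctx n} → S ⊢ Γ → T ⊢ Γ ⋆⁺)
  × (∀ {n} {Γ : Ctx n} {t A : Term n} →
       S ∣ Γ ⊢ t ∶ A → T ∣ Γ ⋆⁺ ⊢ t ⋆ ∶ A ⋆)
  × (∀ {n} {Γ : Ctx n} {t A : Term n} →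
       S ∣ Γ ⊢ t ∶ A → S ∣ Γ ⊢ A ∶ sort TYPE →
       T ∣ Γ ⋆⁺ ⊢ t ⁺ ∶ A ⁺ · t ⋆)
  × (∀ {n} {Γ : Ctx n} {t A : Term n} →
       S ∣ Γ ⊢ t ∶ A → S ∣ Γ ⊢ A ∶ sort KIND →
       T ∣ Γ ⋆⁺ ⊢ t ⁺ ∶ A ⁺⟨ t ⋆ ⟩)
  × (∀ {n} {Γ : Ctx n} {A : Term n} →
       S ∣ Γ ⊢ A ∶ sort KIND →
       (t : Term (n * 2)) → T ∣ Γ ⋆⁺ ⊢ t ∶ A ⋆ →
       T ∣ Γ ⋆⁺ ⊢ A ⁺⟨ t ⟩ ∶ sort KIND)
theorem1 𝕊 𝕋 I =
    translate-ctx
  , (λ ⊢t → star (translate ⊢t))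
  , (λ ⊢t → type (translate ⊢t))
  , (λ ⊢t → kind (translate ⊢t))
  , (λ ⊢A → KIND⁺ (translate ⊢A) refl)
  where
  open Fundamental 𝕊 𝕋 I
  open Translated
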